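{- (a) There is a class $\mathcal{G}$ of convex bipartite grid-intersection graphs that are comparability graphs of $3$-dimensional posets such that $\mathcal{G}$ has unbounded proper odd chromatic number, i.e. $\sup_{G\in\mathcal{G}}\chi_{\mathrm{o}}(G)=\infty$. (b) There is a class $\mathcal{H}$ of bipartite circle graphs of bounded proper odd chromatic number and unbounded proper conflict-free chromatic number, i.e. $\sup_{H\in\mathcal{H}}\chi_{\mathrm{o}}(H)<\infty$ and $\sup_{H\in\mathcal{H}}\chi_{\mathrm{pcf}}(H)=\infty$.
   Context: Graphs are finite and simple. A bipartite graph is convex bipartite if it has a bipartition $(A,B)$ such that for one of the sides, say $A$, there is a linear order of $A$ such that for every $w\in B$ the vertices of $N(w)$ appear consecutively. A grid-intersection graph is a bipartite graph that is the intersection graph of a family of horizontal and vertical segments in the plane in which no two parallel segments intersect. The comparability graph of a poset has the elements as vertices and joins distinct comparable elements. A $3$-dimensional poset is one of (Dushnik–Miller) dimension at most $3$, i.e. its order is an intersection of three linear orders. A circle graph is an intersection graph of chords of a circle. A proper odd (resp. proper conflict-free) coloring is a proper vertex coloring in which for every non-isolated vertex some color appears an odd number of times (resp. exactly once) in its open neighborhood; $\chi_{\mathrm{o}}$ (resp. $\chi_{\mathrm{pcf}}$) is the least number of colors in such a coloring. -}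

module Defs where

open import Level using (0ℓ; suc)
open import Data.Bool.Base using (Bool)
open import Data.Fin.Base using (Fin)
import Data.Fin.Properties as Fin
open import Data.List.Base using (List; map; filter; length; allFin)
open import Data.Nat.Base as ℕ using (ℕ; _%_)
open import Data.Product.Base using (Σ; ∃-syntax; _×_; proj₁; proj₂)
open import Data.Rational.Base as ℚ using (ℚ; 0ℚ; 1ℚ)
open import Data.Sum.Base using (_⊎_)
open import Function.Bundles using (_↔_; _⇔_; Inverse)
open import Relation.Binary.Core using (Rel)
open import Relation.Binary.Definitions using (Decidable; Symmetric)
open import Relation.Binary.PropositionalEquality.Core using (_≡_; _≢_)
open import Relation.Binary.Structures using (IsPartialOrder; IsTotalOrder)
open import Relation.Nullary.Negation.Core using (¬_)
open import Relation.Unary using (Pred)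

------------------------------------------------------------------------
-- Finite simple graphs

record Graph : Set₁ where
  field
    V         : Set
    size      : ℕ
    finite    : V ↔ Fin size
    Adj       : Rel V 0ℓ
    adj?      : Decidable Adj
    symmetric : Symmetric Adj
    loopless  : ∀ v → ¬ Adj v v

  vertices : List V
  vertices = map (Inverse.from finite) (allFin size)

  neighbours : V → List V
  neighbours v = filter (adj? v) vertices

  NonIsolated : V → Set
  NonIsolated v = ∃[ u ] Adj v u

open Graph using (V)

GraphClass : Set₂
GraphClass = Pred Graph (suc 0ℓ)

------------------------------------------------------------------------
-- Colourings

module _ (G : Graph) where
  open Graph G hiding (V)

  Colouring : ℕ → Set
  Colouring k = V G → Fin k

  module _ {k : ℕ} (c : Colouring k) where

    Proper : Set
    Proper = ∀ u v → Adj u v → c u ≢ c v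

    occurrences : V G → Fin k → ℕ
    occurrences v a = length (filter (λ u → c u Fin.≟ a) (neighbours v))

    ProperOdd : Set
    ProperOdd = Proper ×
      (∀ v → NonIsolated v → ∃[ a ] occurrences v a % 2 ≡ 1)

    ProperConflictFree : Set
    ProperConflictFree = Proper ×
      (∀ v → NonIsolated v → ∃[ a ] occurrences v a ≡ 1)

IsLeast : Pred ℕ 0ℓ → ℕ → Set
IsLeast P n = P n × (∀ m → P m → n ℕ.≤ m)

-- Chromatic numbers are given by their graphs: `χₒ G n` reads "χₒ(G) = n".

χₒ : Graph → ℕ → Set
χₒ G = IsLeast (λ k → ∃[ c ] ProperOdd G {k} c)

χpcf : Graph → ℕ → Set
χpcf G = IsLeast (λ k → ∃[ c ] ProperConflictFree G {k} c)

Bounded : (Graph → ℕ → Set) → GraphClass → Set₁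
Bounded χ 𝒢 = ∃[ b ] (∀ G → 𝒢 G → ∃[ n ] (χ G n × n ℕ.≤ b))

Unbounded : (Graph → ℕ → Set) → GraphClass → Set₁
Unbounded χ 𝒢 = ∀ b → ∃[ G ] (𝒢 G × ∃[ n ] (χ G n × b ℕ.< n))

------------------------------------------------------------------------
-- Bipartite and convex bipartite graphs

module _ (G : Graph) where
  open Graph G hiding (V)

  IsBipartition : (V G → Bool) → Set
  IsBipartition side = ∀ u v → Adj u v → side u ≢ side v

  Bipartite : Set
  Bipartite = ∃[ side ] IsBipartition side

  Side : (V G → Bool) → Bool → Set
  Side side s = Σ (V G) λ v → side v ≡ s

  -- N(w) has no gaps in the order.
  Consecutive : ∀ {side s} → Rel (Side side s) 0ℓ → V G → Set
  Consecutive _⊑_ w = ∀ x y z → x ⊑ y → y ⊑ z →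
    Adj w (proj₁ x) → Adj w (proj₁ z) → Adj w (proj₁ y)

  ConvexBipartite : Set₁
  ConvexBipartite =
    Σ (V G → Bool) λ side → IsBipartition side ×
    Σ Bool λ s → Σ (Rel (Side side s) 0ℓ) λ _⊑_ →
      IsTotalOrder _≡_ _⊑_ × (∀ w → side w ≢ s → Consecutive _⊑_ w)

------------------------------------------------------------------------
-- Plane geometry

-- Coordinates are rational.  Two segments with rational endpoints that
-- meet in ℝ² also meet in a rational point, so a family over ℚ² has the
-- same intersection graph when it is read in ℝ².

record Point : Set where
  constructor ⟨_,_⟩
  field
    x y : ℚ

open Point

record Segment : Set where
  field
    start end     : Point
    nondegenerate : start ≢ end

open Segment

_∈ₛ_ : Point → Segment → Set
p ∈ₛ S = ∃[ t ] (0ℚ ℚ.≤ t × t ℚ.≤ 1ℚ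
  × x p ≡ (1ℚ ℚ.- t) ℚ.* x (start S) ℚ.+ t ℚ.* x (end S)
  × y p ≡ (1ℚ ℚ.- t) ℚ.* y (start S) ℚ.+ t ℚ.* y (end S))

Intersect : Rel Segment 0ℓ
Intersect S T = ∃[ p ] (p ∈ₛ S × p ∈ₛ T)

Horizontal Vertical : Pred Segment 0ℓ
Horizontal S = y (start S) ≡ y (end S)
Vertical   S = x (start S) ≡ x (end S)

record Circle : Set where
  field
    centre   : Point
    radius   : ℚ
    positive : 0ℚ ℚ.< radius

open Circle

_∈ₒ_ : Point → Circle → Set
p ∈ₒ C = dx ℚ.* dx ℚ.+ dy ℚ.* dy ≡ radius C ℚ.* radius C
  where
  dx = x p ℚ.- x (centre C)
  dy = y p ℚ.- y (centre C)

IsChord : Circle → Segment → Set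
IsChord C S = start S ∈ₒ C × end S ∈ₒ C

------------------------------------------------------------------------
-- Grid-intersection graphs and circle graphs

module _ (G : Graph) where
  open Graph G hiding (V)

  IsIntersectionGraphOf : (V G → Segment) → Set
  IsIntersectionGraphOf S = ∀ u v → u ≢ v → Adj u v ⇔ Intersect (S u) (S v)

  GridIntersection : Set
  GridIntersection = Bipartite G × ∃[ S ]
    ( IsIntersectionGraphOf S
    × (∀ v → Horizontal (S v) ⊎ Vertical (S v))
    × (∀ u v → u ≢ v → Horizontal (S u) → Horizontal (S v) → ¬ Intersect (S u) (S v))
    × (∀ u v → u ≢ v → Vertical   (S u) → Vertical   (S v) → ¬ Intersect (S u) (S v)))

  CircleGraph : Set
  CircleGraph = ∃[ C ] ∃[ S ]
    ((∀ v → IsChord C (S v)) × IsIntersectionGraphOf S)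

------------------------------------------------------------------------
-- Posets

DimensionAtMost : ℕ → {A : Set} → Rel A 0ℓ → Set₁
DimensionAtMost d {A} _≤_ =
  Σ (Fin d → Rel A 0ℓ) λ L →
    (∀ i → IsTotalOrder _≡_ (L i)) × (∀ u v → u ≤ v ⇔ (∀ i → L i u v))

module _ (G : Graph) where
  open Graph G hiding (V)

  IsComparabilityGraphOf : Rel (V G) 0ℓ → Set
  IsComparabilityGraphOf _≤_ = ∀ u v → Adj u v ⇔ (u ≢ v × (u ≤ v ⊎ v ≤ u))

  ComparabilityGraphOfDimensionAtMost : ℕ → Set₁
  ComparabilityGraphOfDimensionAtMost d =
    Σ (Rel (V G) 0ℓ) λ _≤_ →
      IsPartialOrder _≡_ _≤_ × DimensionAtMost d _≤_ × IsComparabilityGraphOf _≤_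

{-# OPTIONS --safe #-}

-- (a) Take the n points of a line together with all intervals of points.  If a
-- colouring with k colours gave two of the n + 1 prefixes of the line the same
-- parity vector in F₂ᵏ, the interval between them would contain every colour an
-- even number of times; hence n < 2ᵏ.
--
-- (b) Take the leaves and the nodes of the complete ternary tree of even height
-- h, each node joined to the leaves below it.  All degrees are odd, so the
-- bipartition itself is a proper odd colouring.  In a conflict-free colouring
-- the root has a colour occurring on a single leaf, so some child's subtree
-- avoids this colour; inductively more than h colours are needed.

module Submission where

open import Defs
open import Level using (0ℓ)
open import Data.Bool.Base using (Bool; true; false)
open import Data.Empty using (⊥)
open import Data.Fin.Base using (Fin; toℕ; fromℕ<; funToFin; finToFun; combine; punchIn; punchOut)
open import Data.Fin.Patterns using (0F; 1F; 2F)
import Data.Fin.Properties as Fin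
open import Data.Integer.Base as ℤ using (+_; -[1+_]; -<+; -<-)
import Data.Integer.Properties as ℤ
open import Data.List.Base using (List; []; _∷_; length; filter; allFin; _++_; map; cartesianProduct)
open import Data.List.Membership.Propositional using (_∈_)
open import Data.List.Membership.Propositional.Properties
  using (∈-map⁺; ∈-map⁻; ∈-++⁺ˡ; ∈-++⁺ʳ; ∈-filter⁺; ∈-filter⁻; ∈-allFin; ∈-cartesianProduct⁺)
open import Data.List.Membership.Propositional.Properties.WithK using (unique∧set⇒bag)
open import Data.List.Properties using (filter-≐; filter-++; filter-all; filter-none; length-++)
open import Data.List.Relation.Binary.BagAndSetEquality using (∼bag⇒↭)
open import Data.List.Relation.Binary.Permutation.Propositional.Properties using (filter-↭; ↭-length)
open import Data.List.Relation.Unary.All as All using ([]; _∷_)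
open import Data.List.Relation.Unary.AllPairs using ([]; _∷_)
open import Data.List.Relation.Unary.Any using (here; there)
open import Data.List.Relation.Unary.Unique.Propositional using (Unique)
import Data.List.Relation.Unary.Unique.Propositional.Properties as Unique
open import Data.Nat.DivMod using (%-distribˡ-+; %-distribˡ-*; [m+kn]%n≡m%n; m%n<n)
import Data.Nat.Properties as ℕ
open import Data.Product using (Σ; ∃; ∃-syntax; _×_; _,_; proj₁; proj₂)
open import Data.Product.Function.NonDependent.Propositional using (_×-↔_)
open import Data.Rational.Base as ℚ using (ℚ; 0ℚ)
open import Data.Rational.Literals using (fromℤ)
import Data.Rational.Properties as ℚ
open import Data.Rational.Solver using (module +-*-Solver)
open import Data.Sum.Base as Sum using (_⊎_; inj₁; inj₂; [_,_]′)
open import Data.Sum.Function.Propositional using (_⊎-↔_)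
open import Data.Unit.Base using (⊤; tt)
open import Function.Base using (_∘_; id)
open import Function.Bundles using (_↔_; mk⇔; Inverse)
open import Function.Construct.Composition using (_↔-∘_)
open import Function.Construct.Identity using (↔-id)
open import Function.Construct.Symmetry using (↔-sym)
import Relation.Binary.Construct.Flip.EqAndOrd as Flip
open import Relation.Binary.Core using (Rel)
open import Relation.Binary.Definitions using (tri<; tri≈; tri>)
open import Relation.Binary.PropositionalEquality
open import Relation.Binary.Structures using (IsTotalOrder)
open import Relation.Nullary.Decidable
  using (Dec; yes; no; map′; _×-dec_; _→-dec_; ¬?; decidable-stable)
open import Relation.Nullary.Negation.Core using (¬_; contradiction)
open import Relation.Unary using (Pred; Decidable)

-- Both lower bounds look only at the colours on one side, the points or the leaves; the other side
-- lists the sets on which a parity or uniqueness condition is imposed. Arbitrary intervals suit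
-- (a), because horizontal segments may overlap in projection. For (b) the chords of the sets must
-- not meet one another, and a laminar family, the leaf sets of subtrees, achieves this. Branching
-- is odd so that every subtree has an odd number of leaves, and at least two so that a child
-- remains beside the one holding the root's unique colour; three is the least such number. Even
-- height is due to the leaves, each of which is below `h + 1` nodes. Endpoints on the circle come
-- from a rational parameter, and for four distinct parameters two chords cross exactly when the
-- parameters interleave; both directions rest on polynomial identities and signs. Chromatic numbers
-- are relations, so each bound also needs the least value to exist; it is found by a search through
-- colourings, bounded by the one with all colours distinct.

open Point
open Segment

-- Chords of the unit circle

module _ where
  open import Data.Rational.Base
    using (1ℚ; -_; _+_; _*_; _-_; _≤_; _<_; 1/_; positive; nonNegative)
  open +-*-Solver

  pos-* : ∀ {p q} → 0ℚ < p → 0ℚ < q → 0ℚ < p * q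
  pos-* {p} {q} 0<p 0<q =
    ℚ.positive⁻¹ (p * q) {{ℚ.pos*pos⇒pos p {{positive 0<p}} q {{positive 0<q}}}}

  nonNeg-* : ∀ {p q} → 0ℚ ≤ p → 0ℚ ≤ q → 0ℚ ≤ p * q
  nonNeg-* {p} {q} 0≤p 0≤q =
    subst (_≤ p * q) (ℚ.*-zeroʳ p) (ℚ.*-monoˡ-≤-nonNeg p {{nonNegative 0≤p}} 0≤q)

  p<q⇒0<q-p : ∀ {p q} → p < q → 0ℚ < q - p
  p<q⇒0<q-p {p} {q} p<q = subst (_< q - p) (ℚ.+-inverseʳ p) (ℚ.+-monoˡ-< (- p) p<q)

  p≤q⇒0≤q-p : ∀ {p q} → p ≤ q → 0ℚ ≤ q - p
  p≤q⇒0≤q-p {p} {q} p≤q = subst (_≤ q - p) (ℚ.+-inverseʳ p) (ℚ.+-monoˡ-≤ (- p) p≤q)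

  0≤q-p⇒p≤q : ∀ {p q} → 0ℚ ≤ q - p → p ≤ q
  0≤q-p⇒p≤q {p} {q} h =
    subst₂ _≤_ (ℚ.+-identityˡ p) (solve 2 (λ p q → q :- p :+ p := q) refl p q)
      (ℚ.+-monoˡ-≤ p h)

  0≤p² : ∀ p → 0ℚ ≤ p * p
  0≤p² p with ℚ.≤-total 0ℚ p
  ... | inj₁ 0≤p = nonNeg-* 0≤p 0≤p
  ... | inj₂ p≤0 = subst (0ℚ ≤_) (solve 1 (λ p → (:- p) :* (:- p) := p :* p) refl p)
                     (nonNeg-* (ℚ.neg-antimono-≤ p≤0) (ℚ.neg-antimono-≤ p≤0))

  abstract
    -- Abstract, so that `inv u` below stays an opaque factor of which only the positivity and the
    -- defining equation are known.
    reciprocal : ∀ {p} → 0ℚ < p → ∃[ r ] (0ℚ < r × p * r ≡ 1ℚ)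
    reciprocal {p} 0<p = let instance _ = positive 0<p in
      (1/ p) {{ℚ.pos⇒nonZero p}} ,
      ℚ.positive⁻¹ _ {{ℚ.1/pos⇒pos p}} , ℚ.*-inverseʳ p {{ℚ.pos⇒nonZero p}}

  lerp : ℚ → ℚ → ℚ → ℚ
  lerp t p q = (1ℚ - t) * p + t * q

  lerp-≥ : ∀ {t m p q} → 0ℚ ≤ t → t ≤ 1ℚ → m ≤ p → m ≤ q → m ≤ lerp t p q
  lerp-≥ {t} {m} {p} {q} 0≤t t≤1 m≤p m≤q = 0≤q-p⇒p≤q (subst (0ℚ ≤_)
    (solve 4 (λ t m p q → (con 1ℚ :- t) :* (p :- m) :+ t :* (q :- m)
                       := (con 1ℚ :- t) :* p :+ t :* q :- m) refl t m p q)
    (ℚ.+-mono-≤ (nonNeg-* (p≤q⇒0≤q-p t≤1) (p≤q⇒0≤q-p m≤p))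
                (nonNeg-* 0≤t (p≤q⇒0≤q-p m≤q))))

  lerp-neg : ∀ t p q → - lerp t p q ≡ lerp t (- p) (- q)
  lerp-neg = solve 3 (λ t p q → :- ((con 1ℚ :- t) :* p :+ t :* q)
                     := (con 1ℚ :- t) :* (:- p) :+ t :* (:- q)) refl

  lerp-≤ : ∀ {t m p q} → 0ℚ ≤ t → t ≤ 1ℚ → p ≤ m → q ≤ m → lerp t p q ≤ m
  lerp-≤ {t} {m} {p} {q} 0≤t t≤1 p≤m q≤m =
    subst₂ _≤_ (neg-neg _) (neg-neg _) (ℚ.neg-antimono-≤
      (subst (- m ≤_) (sym (lerp-neg t p q))
        (lerp-≥ 0≤t t≤1 (ℚ.neg-antimono-≤ p≤m) (ℚ.neg-antimono-≤ q≤m))))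
    where
    neg-neg : ∀ p → - (- p) ≡ p
    neg-neg = solve 1 (λ p → :- (:- p) := p) refl

  lerp-const : ∀ t p → lerp t p p ≡ p
  lerp-const = solve 2 (λ t p → (con 1ℚ :- t) :* p :+ t :* p := p) refl

  lerp-pos : ∀ {t p q} → 0ℚ ≤ t → t ≤ 1ℚ → 0ℚ < p → 0ℚ < q → 0ℚ < lerp t p q
  lerp-pos {p = p} {q} 0≤t t≤1 0<p 0<q with ℚ.≤-total p q
  ... | inj₁ p≤q = ℚ.<-≤-trans 0<p (lerp-≥ 0≤t t≤1 ℚ.≤-refl p≤q)
  ... | inj₂ q≤p = ℚ.<-≤-trans 0<q (lerp-≥ 0≤t t≤1 q≤p ℚ.≤-refl)

  -- The parameter on the segment is `β / (α + β)`. Weights that need not sum to one keep divisions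
  -- out of the equations, so callers supply polynomial identities.
  barycentric : ∀ {α β p} S → 0ℚ ≤ α → 0ℚ ≤ β → 0ℚ < α + β →
    (α + β) * x p ≡ α * x (start S) + β * x (end S) →
    (α + β) * y p ≡ α * y (start S) + β * y (end S) →
    p ∈ₛ S
  barycentric {α} {β} {p} S 0≤α 0≤β 0<α+β eqx eqy with reciprocal 0<α+β
  ... | r , 0<r , eq =
    β * r , nonNeg-* 0≤β (ℚ.<⇒≤ 0<r) ,
    0≤q-p⇒p≤q (subst (0ℚ ≤_) (sym 1-t) (nonNeg-* 0≤α (ℚ.<⇒≤ 0<r))) ,
    coordinate eqx , coordinate eqy
    where
    open ≡-Reasoning
    1-t : 1ℚ - β * r ≡ α * r
    1-t = trans (cong (_- β * r) (sym eq))
      (solve 3 (λ a b r → (a :+ b) :* r :- b :* r := a :* r) refl α β r)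
    coordinate : ∀ {z a b} → (α + β) * z ≡ α * a + β * b → z ≡ lerp (β * r) a b
    coordinate {z} {a} {b} h = begin
      z                         ≡⟨ ℚ.*-identityˡ z ⟨
      1ℚ * z                    ≡⟨ cong (_* z) eq ⟨
      (α + β) * r * z           ≡⟨ solve 3 (λ s r z → s :* r :* z := r :* (s :* z)) refl (α + β) r z ⟩
      r * ((α + β) * z)         ≡⟨ cong (r *_) h ⟩
      r * (α * a + β * b)       ≡⟨ solve 5 (λ r α β a b → r :* (α :* a :+ β :* b)
                                       := α :* r :* a :+ β :* r :* b) refl r α β a b ⟩
      α * r * a + β * r * b     ≡⟨ cong (λ s → s * a + β * r * b) 1-t ⟨
      lerp (β * r) a b          ∎

  intersect-sym : ∀ {S T} → Intersect S T → Intersect T S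
  intersect-sym (p , p∈S , p∈T) = p , p∈T , p∈S

  unitCircle : Circle
  unitCircle = record { centre = ⟨ 0ℚ , 0ℚ ⟩ ; radius = 1ℚ ; positive = ℚ.positive⁻¹ 1ℚ }

  0<1+p² : ∀ p → 0ℚ < 1ℚ + p * p
  0<1+p² p = ℚ.+-mono-<-≤ (ℚ.positive⁻¹ 1ℚ) (0≤p² p)

  inv : ℚ → ℚ
  inv u = proj₁ (reciprocal (0<1+p² u))

  0<inv : ∀ u → 0ℚ < inv u
  0<inv u = proj₁ (proj₂ (reciprocal (0<1+p² u)))

  inv-inverse : ∀ u → (1ℚ + u * u) * inv u ≡ 1ℚ
  inv-inverse u = proj₂ (proj₂ (reciprocal (0<1+p² u)))

  -- Stereographic projection from (-1, 0), with `u` the tangent of half the angle; increasing `u`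
  -- runs counterclockwise through the circle without that point.
  circlePoint : ℚ → Point
  circlePoint u = ⟨ (1ℚ - u * u) * inv u , (u + u) * inv u ⟩

  circlePoint-∈ : ∀ u → circlePoint u ∈ₒ unitCircle
  circlePoint-∈ u = trans
    (solve 2 (λ u r →
      let X = (con 1ℚ :- u :* u) :* r :- con 0ℚ
          Y = (u :+ u) :* r :- con 0ℚ
          Z = (con 1ℚ :+ u :* u) :* r
      in X :* X :+ Y :* Y := Z :* Z) refl u (inv u))
    (cong₂ _*_ (inv-inverse u) (inv-inverse u))

  -- An equation of the line through the points with parameters s and t.
  line : ℚ → ℚ → Point → ℚ
  line s t p = (1ℚ + s * t) - ((1ℚ - s * t) * x p + (s + t) * y p)

  -- On the circle the equation of the secant becomes a quadratic in `u` with roots `s` and `t`,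
  -- over `1 + u²`. Its sign therefore tells whether `u` lies between `s` and `t`.
  line-circlePoint : ∀ s t u → line s t (circlePoint u) ≡ (1ℚ + 1ℚ) * inv u * ((s - u) * (t - u))
  line-circlePoint s t u = trans
    -- The constant term is multiplied by `(1ℚ + u * u) * inv u`, which is 1, so that every term
    -- carries the factor `inv u`.
    (cong (_- rest)
      (trans (sym (ℚ.*-identityʳ (1ℚ + s * t))) (cong ((1ℚ + s * t) *_) (sym (inv-inverse u)))))
    (solve 4 (λ s t u r →
      (con 1ℚ :+ s :* t) :* ((con 1ℚ :+ u :* u) :* r) :-
        ((con 1ℚ :- s :* t) :* ((con 1ℚ :- u :* u) :* r) :+ (s :+ t) :* ((u :+ u) :* r))
      := (con 1ℚ :+ con 1ℚ) :* r :* ((s :- u) :* (t :- u))) refl s t u (inv u))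
    where rest = (1ℚ - s * t) * x (circlePoint u) + (s + t) * y (circlePoint u)

  line-start : ∀ s t → line s t (circlePoint s) ≡ 0ℚ
  line-start s t = trans (line-circlePoint s t s)
    (solve 3 (λ s t r → r :* ((s :- s) :* (t :- s)) := con 0ℚ) refl s t ((1ℚ + 1ℚ) * inv s))

  line-end : ∀ s t → line s t (circlePoint t) ≡ 0ℚ
  line-end s t = trans (line-circlePoint s t t)
    (solve 3 (λ s t r → r :* ((s :- t) :* (t :- t)) := con 0ℚ) refl s t ((1ℚ + 1ℚ) * inv t))

  line-pos : ∀ s t u → 0ℚ < (s - u) * (t - u) → 0ℚ < line s t (circlePoint u)
  line-pos s t u h = subst (0ℚ <_) (sym (line-circlePoint s t u))
    (pos-* (pos-* (ℚ.positive⁻¹ (1ℚ + 1ℚ)) (0<inv u)) h)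

  line-lerp : ∀ s t {p} S → ((τ , _) : p ∈ₛ S) →
    line s t p ≡ lerp τ (line s t (start S)) (line s t (end S))
  line-lerp s t S (τ , _ , _ , refl , refl) =
    solve 7 (λ s t τ a b c d →
      let L = λ p q → (con 1ℚ :+ s :* t) :- ((con 1ℚ :- s :* t) :* p :+ (s :+ t) :* q)
          M = λ p q → (con 1ℚ :- τ) :* p :+ τ :* q
      in L (M a c) (M b d) := M (L a b) (L c d)) refl
    s t τ (x (start S)) (y (start S)) (x (end S)) (y (end S))

  -- `line v v` is the tangent at `v`: it vanishes there and is positive at the other points of the
  -- parametrisation.
  circlePoint-injective : ∀ {u v} → u < v → circlePoint u ≢ circlePoint v
  circlePoint-injective {u} {v} u<v eq = ℚ.<-irrefl
    (trans (sym (line-start v v)) (cong (line v v) (sym eq)))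
    (line-pos v v u (pos-* (p<q⇒0<q-p u<v) (p<q⇒0<q-p u<v)))

  chord : ∀ {u v} → u < v → Segment
  chord {u} {v} u<v = record
    { start = circlePoint u ; end = circlePoint v ; nondegenerate = circlePoint-injective u<v }

  chord-isChord : ∀ {u v} (u<v : u < v) → IsChord unitCircle (chord u<v)
  chord-isChord {u} {v} _ = circlePoint-∈ u , circlePoint-∈ v

  -- The hypotheses place `u` and `v` outside the range from `s` to `t`. The affine function
  -- `line s t` is then positive at both ends of the second chord, hence all along it, while it
  -- vanishes on the first.
  line-separates : ∀ {s t u v} {s<t : s < t} {u<v : u < v} →
    0ℚ < (s - u) * (t - u) → 0ℚ < (s - v) * (t - v) → ¬ Intersect (chord s<t) (chord u<v)
  line-separates {s} {t} {u} {v} {s<t} {u<v} hu hv (p , p∈ , p∈′@(τ , 0≤τ , τ≤1 , _)) =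
    ℚ.<-irrefl (sym zero-at-p) (subst (0ℚ <_) (sym (line-lerp s t (chord u<v) p∈′))
      (lerp-pos 0≤τ τ≤1 (line-pos s t u hu) (line-pos s t v hv)))
    where
    zero-at-p : line s t p ≡ 0ℚ
    zero-at-p = trans (line-lerp s t (chord s<t) p∈)
      (trans (cong₂ (lerp (proj₁ p∈)) (line-start s t) (line-end s t)) (lerp-const (proj₁ p∈) 0ℚ))

  neg-*-neg : ∀ {s t u} → s < u → t < u → 0ℚ < (s - u) * (t - u)
  neg-*-neg {s} {t} {u} s<u t<u = subst (0ℚ <_)
    (solve 3 (λ s t u → (u :- s) :* (u :- t) := (s :- u) :* (t :- u)) refl s t u)
    (pos-* (p<q⇒0<q-p s<u) (p<q⇒0<q-p t<u))

  disjoint⇒¬intersect : ∀ {s t u v} {s<t : s < t} {u<v : u < v} →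
    t < u → ¬ Intersect (chord s<t) (chord u<v)
  disjoint⇒¬intersect {s<t = s<t} {u<v} t<u =
    line-separates {s<t = s<t} {u<v} (neg-*-neg (ℚ.<-trans s<t t<u) t<u)
      (neg-*-neg (ℚ.<-trans s<t (ℚ.<-trans t<u u<v)) (ℚ.<-trans t<u u<v))

  nested⇒¬intersect : ∀ {s t u v} {s<t : s < t} {u<v : u < v} →
    u < s → t < v → ¬ Intersect (chord s<t) (chord u<v)
  nested⇒¬intersect {s<t = s<t} {u<v} u<s t<v =
    line-separates {s<t = s<t} {u<v}
      (pos-* (p<q⇒0<q-p u<s) (p<q⇒0<q-p (ℚ.<-trans u<s s<t)))
      (neg-*-neg (ℚ.<-trans s<t t<v) t<v)

  -- The third divided difference of a quadratic polynomial vanishes.  Applied to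
  -- 1 - u², 2u and 1 + u² with nodes a < b < c < d, and cleared of denominators, it
  -- exhibits one point as a convex combination on either chord.
  interleaved⇒intersect : ∀ {a b c d} (a<c : a < c) (b<d : b < d) →
    a < b → b < c → c < d → Intersect (chord a<c) (chord b<d)
  interleaved⇒intersect {a} {b} {c} {d} a<c b<d a<b b<c c<d =
    let ρ , _ , eq = reciprocal 0<S
        p = ⟨ ρ * X , ρ * Y ⟩
        scale : ∀ Z → S * (ρ * Z) ≡ Z
        scale Z = trans (sym (ℚ.*-assoc S ρ Z)) (trans (cong (_* Z) eq) (ℚ.*-identityˡ Z))
    in p ,
       barycentric (chord a<c) (ℚ.<⇒≤ 0<α) (ℚ.<⇒≤ 0<γ) 0<S
         (trans (scale X) (sym (cong₂ _+_ (clear wa a (1ℚ - a * a)) (clear wc c (1ℚ - c * c)))))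
         (trans (scale Y) (sym (cong₂ _+_ (clear wa a (a + a)) (clear wc c (c + c))))) ,
       barycentric (chord b<d) (ℚ.<⇒≤ 0<β) (ℚ.<⇒≤ 0<δ) (subst (0ℚ <_) S≡ 0<S)
         (trans (cong (_* (ρ * X)) (sym S≡)) (trans (scale X) (trans X≡
           (sym (cong₂ _+_ (clear wb b (1ℚ - b * b)) (clear wd d (1ℚ - d * d)))))))
         (trans (cong (_* (ρ * Y)) (sym S≡)) (trans (scale Y) (trans Y≡
           (sym (cong₂ _+_ (clear wb b (b + b)) (clear wd d (d + d)))))))
    where
    -- After clearing denominators, the weight at each node is the Vandermonde product of the other
    -- three. The signs alternate, which puts `a` and `c` on one side and `b` and `d` on the other.
    -- The factors `1 + u²` in the weights below cancel the denominators of `circlePoint`.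
    wa = (c - b) * ((d - b) * (d - c))
    wb = (c - a) * ((d - a) * (d - c))
    wc = (b - a) * ((d - a) * (d - b))
    wd = (b - a) * ((c - a) * (c - b))
    α = wa * (1ℚ + a * a)
    β = wb * (1ℚ + b * b)
    γ = wc * (1ℚ + c * c)
    δ = wd * (1ℚ + d * d)
    S = α + γ
    X = wa * (1ℚ - a * a) + wc * (1ℚ - c * c)
    Y = wa * (a + a) + wc * (c + c)

    product-pos : ∀ {p q r s t u} → p < q → r < s → t < u → 0ℚ < (q - p) * ((s - r) * (u - t))
    product-pos p<q r<s t<u = pos-* (p<q⇒0<q-p p<q) (pos-* (p<q⇒0<q-p r<s) (p<q⇒0<q-p t<u))
    a<d = ℚ.<-trans a<c c<d
    0<α = pos-* (product-pos b<c b<d c<d) (0<1+p² a)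
    0<β = pos-* (product-pos a<c a<d c<d) (0<1+p² b)
    0<γ = pos-* (product-pos a<b a<d b<d) (0<1+p² c)
    0<δ = pos-* (product-pos a<b a<c b<c) (0<1+p² d)
    0<S = ℚ.+-mono-< 0<α 0<γ

    clear : ∀ w u z → w * (1ℚ + u * u) * (z * inv u) ≡ w * z
    clear w u z = trans
      (solve 4 (λ w u z r → w :* (con 1ℚ :+ u :* u) :* (z :* r)
                         := w :* z :* ((con 1ℚ :+ u :* u) :* r)) refl w u z (inv u))
      (trans (cong (w * z *_) (inv-inverse u)) (ℚ.*-identityʳ (w * z)))

    S≡ : S ≡ β + δ
    S≡ = solve 4 (λ a b c d →
      (c :- b) :* ((d :- b) :* (d :- c)) :* (con 1ℚ :+ a :* a) :+
      (b :- a) :* ((d :- a) :* (d :- b)) :* (con 1ℚ :+ c :* c)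
      := (c :- a) :* ((d :- a) :* (d :- c)) :* (con 1ℚ :+ b :* b) :+
         (b :- a) :* ((c :- a) :* (c :- b)) :* (con 1ℚ :+ d :* d)) refl a b c d
    X≡ : X ≡ wb * (1ℚ - b * b) + wd * (1ℚ - d * d)
    X≡ = solve 4 (λ a b c d →
      (c :- b) :* ((d :- b) :* (d :- c)) :* (con 1ℚ :- a :* a) :+
      (b :- a) :* ((d :- a) :* (d :- b)) :* (con 1ℚ :- c :* c)
      := (c :- a) :* ((d :- a) :* (d :- c)) :* (con 1ℚ :- b :* b) :+
         (b :- a) :* ((c :- a) :* (c :- b)) :* (con 1ℚ :- d :* d)) refl a b c d
    Y≡ : Y ≡ wb * (b + b) + wd * (d + d)
    Y≡ = solve 4 (λ a b c d →
      (c :- b) :* ((d :- b) :* (d :- c)) :* (a :+ a) :+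
      (b :- a) :* ((d :- a) :* (d :- b)) :* (c :+ c)
      := (c :- a) :* ((d :- a) :* (d :- c)) :* (b :+ b) :+
         (b :- a) :* ((c :- a) :* (c :- b)) :* (d :+ d)) refl a b c d

open import Data.Nat.Base using (ℕ; zero; suc; _+_; _*_; _%_; _^_; _≤_; _<_; z≤n; s≤s; s≤s⁻¹)

-- Existence of chromatic numbers

least : ∀ {P : Pred ℕ 0ℓ} → Decidable P → ∃ P → ∃ (IsLeast P)
least {P} P? (n , Pn) with search n
  where
  search : ∀ n → ∃ (IsLeast P) ⊎ (∀ m → m < n → ¬ P m)
  search zero = inj₂ λ _ ()
  search (suc n) with search n | P? n
  ... | inj₁ l    | _      = inj₁ l
  ... | inj₂ none | yes Pn = inj₁ (n , Pn , λ m Pm → ℕ.≮⇒≥ λ m<n → none m m<n Pm)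
  ... | inj₂ none | no ¬Pn = inj₂ λ m m<1+n Pm →
    none m (ℕ.≤∧≢⇒< (ℕ.≤-pred m<1+n) λ { refl → ¬Pn Pm }) Pm
... | inj₁ l    = l
... | inj₂ none = n , Pn , λ m Pm → ℕ.≮⇒≥ λ m<n → none m m<n Pm

unique∧constant⇒length≡1 : ∀ {A : Set} {x : A} {xs} →
  Unique xs → x ∈ xs → (∀ {y} → y ∈ xs → y ≡ x) → length xs ≡ 1
unique∧constant⇒length≡1 {xs = _ ∷ []} _ _ _ = refl
unique∧constant⇒length≡1 {xs = _ ∷ _ ∷ _} ((y≢z ∷ _) ∷ _) _ const =
  contradiction (trans (const (here refl)) (sym (const (there (here refl))))) y≢z

length≡1⇒unique : ∀ {A : Set} {xs : List A} → length xs ≡ 1 →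
  ∃[ x ] (x ∈ xs × ∀ {y} → y ∈ xs → y ≡ x)
length≡1⇒unique {xs = x ∷ []} refl = x , here refl , λ { (here y≡x) → y≡x }

module _ (G : Graph) where
  open Graph G
  open Inverse finite using (to; from; strictlyInverseˡ; strictlyInverseʳ)

  to-injective : ∀ {u v} → to u ≡ to v → u ≡ v
  to-injective {u} {v} eq =
    trans (sym (strictlyInverseʳ u)) (trans (cong from eq) (strictlyInverseʳ v))

  ∈-vertices : ∀ v → v ∈ vertices
  ∈-vertices v = subst (_∈ vertices) (strictlyInverseʳ v) (∈-map⁺ from (∈-allFin (to v)))

  vertices-unique : Unique vertices
  vertices-unique = Unique.map⁺ from-injective (Unique.allFin⁺ size)
    where
    from-injective : ∀ {i j} → from i ≡ from j → i ≡ j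
    from-injective {i} {j} eq =
      trans (sym (strictlyInverseˡ i)) (trans (cong to eq) (strictlyInverseˡ j))

  ∈-neighbours⁺ : ∀ {u v} → Adj v u → u ∈ neighbours v
  ∈-neighbours⁺ {u} {v} = ∈-filter⁺ (adj? v) (∈-vertices u)

  ∈-neighbours⁻ : ∀ {u v} → u ∈ neighbours v → Adj v u
  ∈-neighbours⁻ {u} {v} = proj₂ ∘ ∈-filter⁻ (adj? v) {xs = vertices}

  ∀V? : ∀ {P : Pred V 0ℓ} → Decidable P → Dec (∀ v → P v)
  ∀V? {P} P? = map′ (λ h v → subst P (strictlyInverseʳ v) (h (to v))) (_∘ from)
    (Fin.all? (P? ∘ from))

  ∃V? : ∀ {P : Pred V 0ℓ} → Decidable P → Dec (∃ P)
  ∃V? {P} P? = map′ (λ (i , p) → from i , p)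
    (λ (v , p) → to v , subst P (sym (strictlyInverseʳ v)) p) (Fin.any? (P? ∘ from))

  -- Colourings are coded as numbers by `funToFin`. Decoding recovers a colouring only pointwise, so
  -- `P` has to respect pointwise equality.
  ∃Colouring? : ∀ {k} {P : Pred (Colouring G k) 0ℓ} → Decidable P →
    (∀ {c c′} → c ≗ c′ → P c → P c′) → Dec (∃ P)
  ∃Colouring? {P = P} P? resp = map′ (λ (i , p) → finToFun i ∘ to , p)
    (λ (c , p) → funToFin (c ∘ from) ,
      resp (λ v → sym (trans (Fin.finToFun-funToFin (c ∘ from) (to v)) (cong c (strictlyInverseʳ v)))) p)
    (Fin.any? λ i → P? (finToFun i ∘ to))

  occurrences≡1⁺ : ∀ {k} (c : Colouring G k) {u v} → Adj v u →
    (∀ w → Adj v w → c w ≡ c u → w ≡ u) → occurrences G c v (c u) ≡ 1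
  occurrences≡1⁺ c {u} {v} vu uniq = unique∧constant⇒length≡1
    (Unique.filter⁺ _ (Unique.filter⁺ _ vertices-unique))
    (∈-filter⁺ _ (∈-neighbours⁺ vu) refl)
    (λ w∈ → let w∈N , cw≡cu = ∈-filter⁻ (λ w → c w Fin.≟ c u) {xs = neighbours v} w∈
            in uniq _ (∈-neighbours⁻ w∈N) cw≡cu)

  occurrences≡1⁻ : ∀ {k} (c : Colouring G k) {v a} → occurrences G c v a ≡ 1 →
    ∃[ u ] (Adj v u × c u ≡ a × ∀ w → Adj v w → c w ≡ a → w ≡ u)
  occurrences≡1⁻ c {v} {a} eq =
    let u , u∈ , uniq = length≡1⇒unique eq
        u∈N , cu≡a = ∈-filter⁻ (λ w → c w Fin.≟ a) {xs = neighbours v} u∈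
    in u , ∈-neighbours⁻ u∈N , cu≡a ,
       λ w vw cw≡a → uniq (∈-filter⁺ _ (∈-neighbours⁺ vw) cw≡a)

  -- Covers both ProperOdd (Q n = n odd) and ProperConflictFree (Q n = n ≡ 1).
  module _ {Q : Pred ℕ 0ℓ} (Q? : Decidable Q) where

    ProperWith : ∀ {k} → Colouring G k → Set
    ProperWith c = Proper G c × (∀ v → NonIsolated v → ∃[ a ] Q (occurrences G c v a))

    properWith? : ∀ {k} → Decidable (ProperWith {k})
    properWith? c =
      (∀V? λ u → ∀V? λ v → adj? u v →-dec ¬? (c u Fin.≟ c v)) ×-dec
      (∀V? λ v → ∃V? (adj? v) →-dec Fin.any? λ a → Q? (occurrences G c v a))

    properWith-resp : ∀ {k} {c c′ : Colouring G k} → c ≗ c′ → ProperWith c → ProperWith c′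
    properWith-resp c≗c′ (proper , q) =
      (λ u v uv eq → proper u v uv (trans (c≗c′ u) (trans eq (sym (c≗c′ v))))) ,
      (λ v ni → let a , h = q v ni in a , subst Q
        (cong length (filter-≐ _ _
          ((λ {u} → trans (sym (c≗c′ u))) , (λ {u} → trans (c≗c′ u))) (neighbours v))) h)

    -- The numbering of the vertices, read as a colouring, shows each neighbour's colour exactly
    -- once; this gives the search for the least number its upper end.
    rainbow : Q 1 → ∃ (ProperWith {size})
    rainbow Q1 = to ,
      (λ u v uv eq → loopless u (subst (Adj u) (sym (to-injective eq)) uv)) ,
      (λ v (u , vu) → to u ,
        subst Q (sym (occurrences≡1⁺ to vu (λ _ _ → to-injective))) Q1)

    chromaticNumber : Q 1 → ∃ (IsLeast (λ k → ∃ (ProperWith {k})))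
    chromaticNumber Q1 = least (λ k → ∃Colouring? properWith? properWith-resp) (size , rainbow Q1)

-- Incidence graphs

Finite : Set → Set
Finite A = ∃[ n ] (A ↔ Fin n)

finite-Fin : ∀ n → Finite (Fin n)
finite-Fin n = n , ↔-id _

finite-⊎ : ∀ {A B} → Finite A → Finite B → Finite (A ⊎ B)
finite-⊎ (m , f) (n , g) = m + n , (↔-sym Fin.+↔⊎ ↔-∘ (f ⊎-↔ g))

finite-× : ∀ {A B} → Finite A → Finite B → Finite (A × B)
finite-× (m , f) (n , g) = m * n , (↔-sym Fin.*↔× ↔-∘ (f ×-↔ g))

module _ {A B : Set} (R : A → B → Set) where

  Incident : A ⊎ B → A ⊎ B → Set
  Incident (inj₁ a) (inj₂ b) = R a b
  Incident (inj₂ b) (inj₁ a) = R a b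
  Incident (inj₁ _) (inj₁ _) = ⊥
  Incident (inj₂ _) (inj₂ _) = ⊥

  incidenceGraph : Finite A → Finite B → (∀ a b → Dec (R a b)) → Graph
  incidenceGraph fA fB R? = record
    { V         = A ⊎ B
    ; size      = proj₁ (finite-⊎ fA fB)
    ; finite    = proj₂ (finite-⊎ fA fB)
    ; Adj       = Incident
    ; adj?      = λ { (inj₁ a) (inj₂ b) → R? a b
                    ; (inj₂ b) (inj₁ a) → R? a b
                    ; (inj₁ _) (inj₁ _) → no λ ()
                    ; (inj₂ _) (inj₂ _) → no λ () }
    ; symmetric = λ { {inj₁ _} {inj₂ _} r → r ; {inj₂ _} {inj₁ _} r → r }
    ; loopless  = λ { (inj₁ _) () ; (inj₂ _) () }
    }

  isPoint : A ⊎ B → Bool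
  isPoint (inj₁ _) = true
  isPoint (inj₂ _) = false

  incident⇒sides≢ : ∀ u v → Incident u v → isPoint u ≢ isPoint v
  incident⇒sides≢ (inj₁ _) (inj₂ _) _ ()
  incident⇒sides≢ (inj₂ _) (inj₁ _) _ ()

-- The nested filters have the shape of `occurrences`. The hypotheses make `S` the disjoint union of
-- `R` and the conjunction of `P` and `Q`: a longer prefix splits into a shorter one and an
-- interval.
length-filter-∪ : ∀ {A : Set} {P Q R S : Pred A 0ℓ}
  (P? : Decidable P) (Q? : Decidable Q) (R? : Decidable R) (S? : Decidable S) →
  (∀ {x} → Q x → P x → ¬ R x) → (∀ {x} → Q x → P x → S x) → (∀ {x} → R x → S x) →
  (∀ {x} → S x → Q x × P x ⊎ R x) → ∀ xs →
  length (filter P? (filter Q? xs)) + length (filter R? xs) ≡ length (filter S? xs)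
length-filter-∪ P? Q? R? S? disj pq⇒s r⇒s s⇒ = go
  where
  go : ∀ xs → length (filter P? (filter Q? xs)) + length (filter R? xs) ≡ length (filter S? xs)
  go [] = refl
  go (x ∷ xs) with Q? x
  go (x ∷ xs) | yes q with P? x
  go (x ∷ xs) | yes q | yes p with R? x | S? x
  ... | yes r | _     = contradiction r (disj q p)
  ... | no _  | yes _ = cong suc (go xs)
  ... | no _  | no ¬s = contradiction (pq⇒s q p) ¬s
  go (x ∷ xs) | yes q | no ¬p with R? x | S? x
  ... | yes _ | yes _ = trans (ℕ.+-suc _ _) (cong suc (go xs))
  ... | yes r | no ¬s = contradiction (r⇒s r) ¬s
  ... | no _  | no _  = go xs
  ... | no ¬r | yes s with s⇒ s
  ... | inj₁ (_ , p) = contradiction p ¬p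
  ... | inj₂ r       = contradiction r ¬r
  go (x ∷ xs) | no ¬q with R? x | S? x
  ... | yes _ | yes _ = trans (ℕ.+-suc _ _) (cong suc (go xs))
  ... | yes r | no ¬s = contradiction (r⇒s r) ¬s
  ... | no _  | no _  = go xs
  ... | no ¬r | yes s with s⇒ s
  ... | inj₁ (q , _) = contradiction q ¬q
  ... | inj₂ r       = contradiction r ¬r

%2-flip : ∀ m n → m % 2 ≡ 1 → (m + n) % 2 ≢ n % 2
%2-flip m n odd eq = absurd (m%n<n n 2) (begin
  (1 + n % 2) % 2         ≡⟨ cong (λ r → (r + n % 2) % 2) odd ⟨
  (m % 2 + n % 2) % 2     ≡⟨ %-distribˡ-+ m n 2 ⟨
  (m + n) % 2             ≡⟨ eq ⟩
  n % 2                   ∎)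
  where
  open ≡-Reasoning
  absurd : ∀ {r} → r < 2 → (1 + r) % 2 ≢ r
  absurd (s≤s z≤n) ()
  absurd (s≤s (s≤s z≤n)) ()

-- The interval graph

module _ (n : ℕ) where

  -- (i , l) stands for the interval from i to i + l, which may reach beyond n.
  Interval : Set
  Interval = Fin n × Fin n

  first last : Interval → ℕ
  first (i , l) = toℕ i
  last  (i , l) = toℕ i + toℕ l

  _∈ᵢ_ : Fin n → Interval → Set
  a ∈ᵢ I = first I ≤ toℕ a × toℕ a ≤ last I

  intervalGraph : Graph
  intervalGraph = incidenceGraph _∈ᵢ_ (finite-Fin n) (finite-× (finite-Fin n) (finite-Fin n))
    λ a I → first I ℕ.≤? toℕ a ×-dec toℕ a ℕ.≤? last I

  module _ {k} (c : Colouring intervalGraph k) where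
    open Graph intervalGraph

    -- A predicate on all vertices, not only on points, so that prefixes are counted along the same
    -- list as `occurrences`.
    Prefix : ℕ → Fin k → V → Set
    Prefix m a (inj₁ x) = toℕ x < m × c (inj₁ x) ≡ a
    Prefix m a (inj₂ _) = ⊥

    prefix? : ∀ m a → Decidable (Prefix m a)
    prefix? m a (inj₁ x) = toℕ x ℕ.<? m ×-dec c (inj₁ x) Fin.≟ a
    prefix? m a (inj₂ _) = no λ ()

    prefixCount : ℕ → Fin k → ℕ
    prefixCount m a = length (filter (prefix? m a) vertices)

    prefixCount-step : ∀ I a →
      occurrences intervalGraph c (inj₂ I) a + prefixCount (first I) a
        ≡ prefixCount (suc (last I)) a
    prefixCount-step I a = length-filter-∪
      (λ v → c v Fin.≟ a) (adj? (inj₂ I)) (prefix? (first I) a) (prefix? (suc (last I)) a)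
      (λ { {inj₁ x} (i≤x , _) _ (x<i , _) → ℕ.<⇒≱ x<i i≤x })
      (λ { {inj₁ x} (_ , x≤j) cx → s≤s x≤j , cx })
      (λ { {inj₁ x} (x<i , cx) → ℕ.<-trans x<i (s≤s (ℕ.m≤m+n (first I) _)) , cx })
      (λ { {inj₁ x} (x<sj , cx) → split x x<sj cx })
      vertices
      where
      split : ∀ x → toℕ x < suc (last I) → c (inj₁ x) ≡ a →
        (first I ≤ toℕ x × toℕ x ≤ last I) × c (inj₁ x) ≡ a ⊎ toℕ x < first I × c (inj₁ x) ≡ a
      split x x<sj cx with first I ℕ.≤? toℕ x
      ... | yes i≤x = inj₁ ((i≤x , s≤s⁻¹ x<sj) , cx)
      ... | no i≰x  = inj₂ (ℕ.≰⇒> i≰x , cx)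

    prefixParity : ℕ → Fin k → Fin 2
    prefixParity m a = fromℕ< (m%n<n (prefixCount m a) 2)

    properOdd⇒n<2^k : ProperOdd intervalGraph c → n < 2 ^ k
    properOdd⇒n<2^k (_ , odd) = ℕ.≰⇒> λ 2^k≤n →
      let p , q , p<q , eq = Fin.pigeonhole (s≤s 2^k≤n)
                               (λ (m : Fin (suc n)) → funToFin (prefixParity (toℕ m)))
          q≤n    = s≤s⁻¹ (Fin.toℕ<n q)
          p<n    = ℕ.<-≤-trans p<q q≤n
          -- The second component of the interval is `q - (p + 1)`: the interval runs from `p` to
          -- `q - 1`, and the prefix ending with it is the one of length `q`.
          l<n    = ℕ.<-≤-trans (ℕ.∸-monoʳ-< {toℕ q} {suc (toℕ p)} {0} (s≤s z≤n) p<q) q≤n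
          I      = fromℕ< p<n , fromℕ< l<n
          first≡ = Fin.toℕ-fromℕ< p<n
          last≡  = trans (cong₂ (λ i l → suc (i + l)) first≡ (Fin.toℕ-fromℕ< l<n))
                         (ℕ.m+[n∸m]≡n p<q)
          a , odd-a = odd (inj₂ I) (inj₁ (fromℕ< p<n) , ℕ.≤-refl , ℕ.m≤m+n _ _)
      in %2-flip (occurrences intervalGraph c (inj₂ I) a) (prefixCount (first I) a) odd-a (begin
           (occurrences intervalGraph c (inj₂ I) a + prefixCount (first I) a) % 2
             ≡⟨ cong (_% 2) (prefixCount-step I a) ⟩
           prefixCount (suc (last I)) a % 2
             ≡⟨ cong (λ m → prefixCount m a % 2) last≡ ⟩
           prefixCount (toℕ q) a % 2
             ≡⟨ same-parity p q eq a ⟨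
           prefixCount (toℕ p) a % 2
             ≡⟨ cong (λ m → prefixCount m a % 2) first≡ ⟨
           prefixCount (first I) a % 2
             ∎)
      where
      open ≡-Reasoning
      same-parity : ∀ (p q : Fin (suc n)) →
        funToFin (prefixParity (toℕ p)) ≡ funToFin (prefixParity (toℕ q)) →
        ∀ a → prefixCount (toℕ p) a % 2 ≡ prefixCount (toℕ q) a % 2
      same-parity p q eq a = begin
        prefixCount (toℕ p) a % 2             ≡⟨ Fin.toℕ-fromℕ< _ ⟨
        toℕ (prefixParity (toℕ p) a)          ≡⟨ cong toℕ (Fin.finToFun-funToFin (prefixParity (toℕ p)) a) ⟨
        toℕ (finToFun (funToFin (prefixParity (toℕ p))) a)
                                              ≡⟨ cong (λ i → toℕ (finToFun i a)) eq ⟩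
        toℕ (finToFun (funToFin (prefixParity (toℕ q))) a)
                                              ≡⟨ cong toℕ (Fin.finToFun-funToFin (prefixParity (toℕ q)) a) ⟩
        toℕ (prefixParity (toℕ q) a)          ≡⟨ Fin.toℕ-fromℕ< _ ⟩
        prefixCount (toℕ q) a % 2             ∎

-- Integer coordinates and axis-parallel segments

fromℤ-mono-≤ : ∀ {i j} → i ℤ.≤ j → fromℤ i ℚ.≤ fromℤ j
fromℤ-mono-≤ {i} {j} i≤j =
  ℚ.*≤* (subst₂ ℤ._≤_ (sym (ℤ.*-identityʳ i)) (sym (ℤ.*-identityʳ j)) i≤j)

fromℤ-mono-< : ∀ {i j} → i ℤ.< j → fromℤ i ℚ.< fromℤ j
fromℤ-mono-< {i} {j} i<j =
  ℚ.*<* (subst₂ ℤ._<_ (sym (ℤ.*-identityʳ i)) (sym (ℤ.*-identityʳ j)) i<j)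

fromℤ-cancel-≤ : ∀ {i j} → fromℤ i ℚ.≤ fromℤ j → i ℤ.≤ j
fromℤ-cancel-≤ {i} {j} h =
  subst₂ ℤ._≤_ (ℤ.*-identityʳ i) (ℤ.*-identityʳ j) (ℚ.drop-*≤* h)

fromℕ : ℕ → ℚ
fromℕ n = fromℤ (+ n)

fromℕ-mono-≤ : ∀ {m n} → m ≤ n → fromℕ m ℚ.≤ fromℕ n
fromℕ-mono-≤ m≤n = fromℤ-mono-≤ (ℤ.+≤+ m≤n)

fromℕ-mono-< : ∀ {m n} → m < n → fromℕ m ℚ.< fromℕ n
fromℕ-mono-< m<n = fromℤ-mono-< (ℤ.+<+ m<n)

fromℕ-cancel-≤ : ∀ {m n} → fromℕ m ℚ.≤ fromℕ n → m ≤ n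
fromℕ-cancel-≤ h = ℤ.drop‿+≤+ (fromℤ-cancel-≤ h)

fromℕ-injective : ∀ {m n} → fromℕ m ≡ fromℕ n → m ≡ n
fromℕ-injective refl = refl

horizontalSegment : ∀ {l r} → l ℚ.< r → ℚ → Segment
horizontalSegment {l} {r} l<r h = record
  { start = ⟨ l , h ⟩ ; end = ⟨ r , h ⟩
  ; nondegenerate = λ eq → ℚ.<-irrefl (cong x eq) l<r }

verticalSegment : ∀ {l r} → l ℚ.< r → ℚ → Segment
verticalSegment {l} {r} l<r w = record
  { start = ⟨ w , l ⟩ ; end = ⟨ w , r ⟩
  ; nondegenerate = λ eq → ℚ.<-irrefl (cong y eq) l<r }

module _ {l r} (l<r : l ℚ.< r) where

  private
    sum≡ : ∀ z → (r ℚ.- z) ℚ.+ (z ℚ.- l) ≡ r ℚ.- l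
    sum≡ = solve 3 (λ l r z → (r :- z) :+ (z :- l) := r :- l) refl l r
      where open +-*-Solver
    moving : ∀ z → ((r ℚ.- z) ℚ.+ (z ℚ.- l)) ℚ.* z ≡ (r ℚ.- z) ℚ.* l ℚ.+ (z ℚ.- l) ℚ.* r
    moving = solve 3 (λ l r z → ((r :- z) :+ (z :- l)) :* z := (r :- z) :* l :+ (z :- l) :* r) refl l r
      where open +-*-Solver
    constant : ∀ α β h → (α ℚ.+ β) ℚ.* h ≡ α ℚ.* h ℚ.+ β ℚ.* h
    constant α β h = ℚ.*-distribʳ-+ h α β
    0<sum : ∀ z → 0ℚ ℚ.< (r ℚ.- z) ℚ.+ (z ℚ.- l)
    0<sum z = subst (0ℚ ℚ.<_) (sym (sum≡ z)) (p<q⇒0<q-p l<r)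

  ∈-horizontal⁺ : ∀ {z h} → l ℚ.≤ z → z ℚ.≤ r → ⟨ z , h ⟩ ∈ₛ horizontalSegment l<r h
  ∈-horizontal⁺ {z} {h} l≤z z≤r = barycentric (horizontalSegment l<r h)
    (p≤q⇒0≤q-p z≤r) (p≤q⇒0≤q-p l≤z) (0<sum z) (moving z) (constant (r ℚ.- z) (z ℚ.- l) h)

  ∈-vertical⁺ : ∀ {z w} → l ℚ.≤ z → z ℚ.≤ r → ⟨ w , z ⟩ ∈ₛ verticalSegment l<r w
  ∈-vertical⁺ {z} {w} l≤z z≤r = barycentric (verticalSegment l<r w)
    (p≤q⇒0≤q-p z≤r) (p≤q⇒0≤q-p l≤z) (0<sum z) (constant (r ℚ.- z) (z ℚ.- l) w) (moving z)

  ∈-horizontal⁻ : ∀ {p h} → p ∈ₛ horizontalSegment l<r h → l ℚ.≤ x p × x p ℚ.≤ r × y p ≡ h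
  ∈-horizontal⁻ {h = h} (t , 0≤t , t≤1 , refl , eq) =
    lerp-≥ 0≤t t≤1 ℚ.≤-refl (ℚ.<⇒≤ l<r) , lerp-≤ 0≤t t≤1 (ℚ.<⇒≤ l<r) ℚ.≤-refl ,
    trans eq (lerp-const t h)

  ∈-vertical⁻ : ∀ {p w} → p ∈ₛ verticalSegment l<r w → x p ≡ w
  ∈-vertical⁻ {w = w} (t , _ , _ , eq , _) = trans eq (lerp-const t w)

-- Lexicographic orders

infix 4 _≤ₗ_

_≤ₗ_ : Rel (ℕ × ℕ) 0ℓ
(a , b) ≤ₗ (c , d) = a < c ⊎ a ≡ c × b ≤ d

≤ₗ-antisym : ∀ {p q} → p ≤ₗ q → q ≤ₗ p → p ≡ q
≤ₗ-antisym (inj₁ a<c) (inj₁ c<a) = contradiction c<a (ℕ.<-asym a<c)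
≤ₗ-antisym (inj₁ a<c) (inj₂ (refl , _)) = contradiction a<c (ℕ.<-irrefl refl)
≤ₗ-antisym (inj₂ (refl , _)) (inj₁ c<a) = contradiction c<a (ℕ.<-irrefl refl)
≤ₗ-antisym (inj₂ (refl , b≤d)) (inj₂ (_ , d≤b)) = cong (_ ,_) (ℕ.≤-antisym b≤d d≤b)

≤ₗ-trans : ∀ {p q r} → p ≤ₗ q → q ≤ₗ r → p ≤ₗ r
≤ₗ-trans (inj₁ a<c) (inj₁ c<e) = inj₁ (ℕ.<-trans a<c c<e)
≤ₗ-trans (inj₁ a<c) (inj₂ (refl , _)) = inj₁ a<c
≤ₗ-trans (inj₂ (refl , _)) (inj₁ c<e) = inj₁ c<e
≤ₗ-trans (inj₂ (refl , b≤d)) (inj₂ (refl , d≤f)) = inj₂ (refl , ℕ.≤-trans b≤d d≤f)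

≤ₗ-total : ∀ p q → p ≤ₗ q ⊎ q ≤ₗ p
≤ₗ-total (a , b) (c , d) with ℕ.<-cmp a c
... | tri< a<c _ _ = inj₁ (inj₁ a<c)
... | tri> _ _ c<a = inj₂ (inj₁ c<a)
... | tri≈ _ refl _ with ℕ.≤-total b d
... | inj₁ b≤d = inj₁ (inj₂ (refl , b≤d))
... | inj₂ d≤b = inj₂ (inj₂ (refl , d≤b))

≤ₗ⇒≤ : ∀ {p q} → p ≤ₗ q → proj₁ p ≤ proj₁ q
≤ₗ⇒≤ (inj₁ a<c)      = ℕ.<⇒≤ a<c
≤ₗ⇒≤ (inj₂ (refl , _)) = ℕ.≤-refl

key-isTotalOrder : ∀ {A : Set} (f : A → ℕ × ℕ) → (∀ {u v} → f u ≡ f v → u ≡ v) →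
  IsTotalOrder _≡_ (λ u v → f u ≤ₗ f v)
key-isTotalOrder f injective = record
  { isPartialOrder = record
    { isPreorder = record
      { isEquivalence = isEquivalence
      ; reflexive = λ { refl → inj₂ (refl , ℕ.≤-refl) }
      ; trans = ≤ₗ-trans }
    ; antisym = λ u≤v v≤u → injective (≤ₗ-antisym u≤v v≤u) }
  ; total = λ u v → ≤ₗ-total (f u) (f v) }

-- Convexity, segments and linear orders for the interval graph

module _ (n : ℕ) where
  private
    G = intervalGraph n
    V = Graph.V G

  intervalGraph-bipartite : Bipartite G
  intervalGraph-bipartite = isPoint (_∈ᵢ_ n) , incident⇒sides≢ (_∈ᵢ_ n)

  intervalGraph-convexBipartite : ConvexBipartite G
  intervalGraph-convexBipartite =
    isPoint (_∈ᵢ_ n) , incident⇒sides≢ (_∈ᵢ_ n) , true ,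
    (λ u v → position u ≤ₗ position v) ,
    key-isTotalOrder position (λ {u} {v} → position-injective {u} {v}) , consecutive
    where
    P = Side G (isPoint (_∈ᵢ_ n)) true
    -- A pair with constant second entry, so that `key-isTotalOrder` applies.
    position : P → ℕ × ℕ
    position (inj₁ a , _) = toℕ a , 0
    position-injective : ∀ {u v} → position u ≡ position v → u ≡ v
    position-injective {inj₁ a , refl} {inj₁ b , refl} eq
      with refl ← Fin.toℕ-injective (cong proj₁ eq) = refl
    consecutive : ∀ w → isPoint (_∈ᵢ_ n) w ≢ true → Consecutive G (λ u v → position u ≤ₗ position v) w
    consecutive (inj₁ _) w≢ = contradiction refl w≢
    consecutive (inj₂ I) _ (inj₁ a , _) (inj₁ b , _) (inj₁ c , _) a≤b b≤c (i≤a , _) (_ , c≤j) =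
      ℕ.≤-trans i≤a (≤ₗ⇒≤ a≤b) , ℕ.≤-trans (≤ₗ⇒≤ b≤c) c≤j

  -- Doubled coordinates leave room for one-element intervals to be nondegenerate.
  column : fromℕ 0 ℚ.< fromℕ (suc (n * n))
  column = fromℕ-mono-< (s≤s z≤n)

  row : ∀ I → fromℕ (2 * first n I) ℚ.< fromℕ (suc (2 * last n I))
  row (i , l) = fromℕ-mono-< (s≤s (ℕ.*-monoʳ-≤ 2 (ℕ.m≤m+n (toℕ i) (toℕ l))))

  -- `combine` numbers the intervals injectively below `n * n`. Each horizontal segment thus has a
  -- height of its own, within the vertical extent of every column.
  segment : V → Segment
  segment (inj₁ a)         = verticalSegment column (fromℕ (2 * toℕ a))
  segment (inj₂ I@(i , l)) = horizontalSegment (row I) (fromℕ (toℕ (combine i l)))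

  ∈ᵢ⇒intersect : ∀ {a I} → _∈ᵢ_ n a I → Intersect (segment (inj₁ a)) (segment (inj₂ I))
  ∈ᵢ⇒intersect {a} {i , l} (i≤a , a≤j) =
    ⟨ fromℕ (2 * toℕ a) , fromℕ (toℕ (combine i l)) ⟩ ,
    ∈-vertical⁺ column (fromℕ-mono-≤ z≤n) (fromℕ-mono-≤ (ℕ.<⇒≤ (ℕ.m<n⇒m<1+n (Fin.toℕ<n (combine i l))))) ,
    ∈-horizontal⁺ (row (i , l)) (fromℕ-mono-≤ (ℕ.*-monoʳ-≤ 2 i≤a))
      (fromℕ-mono-≤ (ℕ.m≤n⇒m≤1+n (ℕ.*-monoʳ-≤ 2 a≤j)))

  intersect⇒∈ᵢ : ∀ {a I} → Intersect (segment (inj₁ a)) (segment (inj₂ I)) → _∈ᵢ_ n a I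
  intersect⇒∈ᵢ {a} {I} (p , p∈a , p∈I) =
    ℕ.*-cancelˡ-≤ 2 (fromℕ-cancel-≤ {2 * first n I} {2 * toℕ a} (subst (_ ℚ.≤_) x≡ l≤x)) ,
    -- With `j` the last element, `2a ≤ 2j + 1 < 2(j + 1)` gives `a ≤ j`: the extra unit at the
    -- right end reaches no further column.
    s≤s⁻¹ (ℕ.*-cancelˡ-< 2 (toℕ a) (suc (last n I))
      (subst (2 * toℕ a <_) (sym (ℕ.*-suc 2 (last n I)))
        (s≤s (fromℕ-cancel-≤ {2 * toℕ a} {suc (2 * last n I)} (subst (ℚ._≤ _) x≡ x≤r)))))
    where
    x≡ : x p ≡ fromℕ (2 * toℕ a)
    x≡ = ∈-vertical⁻ column p∈a
    bounds : fromℕ (2 * first n I) ℚ.≤ x p × x p ℚ.≤ fromℕ (suc (2 * last n I)) × _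
    bounds = ∈-horizontal⁻ (row I) p∈I
    l≤x = proj₁ bounds
    x≤r = proj₁ (proj₂ bounds)

  points-disjoint : ∀ {a b} → a ≢ b → ¬ Intersect (segment (inj₁ a)) (segment (inj₁ b))
  points-disjoint a≢b (p , p∈a , p∈b) = a≢b (Fin.toℕ-injective (ℕ.*-cancelˡ-≡ _ _ 2
    (fromℕ-injective (trans (sym (∈-vertical⁻ column p∈a)) (∈-vertical⁻ column p∈b)))))

  intervals-disjoint : ∀ {I J} → I ≢ J → ¬ Intersect (segment (inj₂ I)) (segment (inj₂ J))
  intervals-disjoint {i , l} {j , m} I≢J (p , p∈I , p∈J)
    with refl , refl ← Fin.combine-injective i l j m (Fin.toℕ-injective (fromℕ-injective
           (trans (sym (proj₂ (proj₂ (∈-horizontal⁻ (row (i , l)) p∈I))))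
                  (proj₂ (proj₂ (∈-horizontal⁻ (row (j , m)) p∈J))))))
    = I≢J refl

  intervalGraph-gridIntersection : GridIntersection G
  intervalGraph-gridIntersection = intervalGraph-bipartite , segment , intersection ,
    (λ { (inj₁ _) → inj₂ refl ; (inj₂ _) → inj₁ refl }) , horizontals , verticals
    where
    intersection : IsIntersectionGraphOf G segment
    intersection (inj₁ a) (inj₂ I) _ = mk⇔ ∈ᵢ⇒intersect intersect⇒∈ᵢ
    intersection (inj₂ I) (inj₁ a) _ =
      mk⇔ (λ a∈I → intersect-sym {segment (inj₁ a)} {segment (inj₂ I)} (∈ᵢ⇒intersect a∈I))
          (λ h → intersect⇒∈ᵢ (intersect-sym {segment (inj₂ I)} {segment (inj₁ a)} h))
    intersection (inj₁ a) (inj₁ b) a≢b = mk⇔ (λ ()) (points-disjoint (a≢b ∘ cong inj₁))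
    intersection (inj₂ I) (inj₂ J) I≢J = mk⇔ (λ ()) (intervals-disjoint (I≢J ∘ cong inj₂))

    vertical≢horizontal : ∀ {a} → ¬ Horizontal (segment (inj₁ a))
    vertical≢horizontal eq with () ← fromℕ-injective eq
    horizontal≢vertical : ∀ {I} → ¬ Vertical (segment (inj₂ I))
    horizontal≢vertical {i , l} eq =
      ℕ.1+n≰n (ℕ.≤-trans (ℕ.≤-reflexive (sym (fromℕ-injective eq)))
        (ℕ.*-monoʳ-≤ 2 (ℕ.m≤m+n (toℕ i) (toℕ l))))

    horizontals : ∀ u v → u ≢ v → Horizontal (segment u) → Horizontal (segment v) →
      ¬ Intersect (segment u) (segment v)
    horizontals (inj₁ a) _ _ h _ = contradiction h (vertical≢horizontal {a})
    horizontals (inj₂ _) (inj₁ b) _ _ h = contradiction h (vertical≢horizontal {b})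
    horizontals (inj₂ I) (inj₂ J) I≢J _ _ = intervals-disjoint (I≢J ∘ cong inj₂)
    verticals : ∀ u v → u ≢ v → Vertical (segment u) → Vertical (segment v) →
      ¬ Intersect (segment u) (segment v)
    verticals (inj₂ I) _ _ h _ = contradiction h (horizontal≢vertical {I})
    verticals (inj₁ _) (inj₂ J) _ _ h = contradiction h (horizontal≢vertical {J})
    verticals (inj₁ a) (inj₁ b) a≢b _ _ = points-disjoint (a≢b ∘ cong inj₁)

  -- The first two keys already order points below the intervals containing them,
  -- but also nested intervals; the third one makes intervals incomparable.
  byLast byFirst byLastIntervalsFirst : V → ℕ × ℕ
  byLast (inj₁ a)               = toℕ a , 0
  byLast (inj₂ I)               = last n I , suc (first n I)
  byFirst (inj₁ a)              = toℕ a , n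
  byFirst (inj₂ I@(i , l))      = first n I , toℕ l
  byLastIntervalsFirst (inj₁ a) = (n + n) + toℕ a , 0
  byLastIntervalsFirst (inj₂ I) = byLast (inj₂ I)

  last<2n : ∀ I → last n I < n + n
  last<2n (i , l) = ℕ.+-mono-< (Fin.toℕ<n i) (Fin.toℕ<n l)

  interval-ext : ∀ {I J} → first n I ≡ first n J → last n I ≡ last n J → I ≡ J
  interval-ext {i , l} {j , m} eq₁ eq₂ with refl ← Fin.toℕ-injective eq₁ =
    cong (i ,_) (Fin.toℕ-injective (ℕ.+-cancelˡ-≡ (toℕ i) _ _ eq₂))

  byLast-injective : ∀ {u v} → byLast u ≡ byLast v → u ≡ v
  byLast-injective {inj₁ a} {inj₁ b} eq = cong inj₁ (Fin.toℕ-injective (cong proj₁ eq))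
  byLast-injective {inj₂ I} {inj₂ J} eq =
    cong inj₂ (interval-ext (ℕ.suc-injective (cong proj₂ eq)) (cong proj₁ eq))
  byLast-injective {inj₁ a} {inj₂ J} eq with () ← cong proj₂ eq
  byLast-injective {inj₂ I} {inj₁ b} eq with () ← cong proj₂ eq

  byFirst-injective : ∀ {u v} → byFirst u ≡ byFirst v → u ≡ v
  byFirst-injective {inj₁ a} {inj₁ b} eq = cong inj₁ (Fin.toℕ-injective (cong proj₁ eq))
  byFirst-injective {inj₂ (i , l)} {inj₂ (j , m)} eq = cong inj₂
    (cong₂ _,_ (Fin.toℕ-injective (cong proj₁ eq)) (Fin.toℕ-injective (cong proj₂ eq)))
  byFirst-injective {inj₁ a} {inj₂ (j , m)} eq = contradiction (sym (cong proj₂ eq)) (ℕ.<⇒≢ (Fin.toℕ<n m))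
  byFirst-injective {inj₂ (i , l)} {inj₁ b} eq = contradiction (cong proj₂ eq) (ℕ.<⇒≢ (Fin.toℕ<n l))

  byLastIntervalsFirst-injective : ∀ {u v} →
    byLastIntervalsFirst u ≡ byLastIntervalsFirst v → u ≡ v
  byLastIntervalsFirst-injective {inj₁ a} {inj₁ b} eq =
    cong inj₁ (Fin.toℕ-injective (ℕ.+-cancelˡ-≡ (n + n) _ _ (cong proj₁ eq)))
  byLastIntervalsFirst-injective {inj₂ I} {inj₂ J} eq = byLast-injective eq
  byLastIntervalsFirst-injective {inj₁ a} {inj₂ J} eq with () ← cong proj₂ eq
  byLastIntervalsFirst-injective {inj₂ I} {inj₁ b} eq with () ← cong proj₂ eq

  linear : Fin 3 → Rel V 0ℓ
  linear 0F u v = byLast u ≤ₗ byLast v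
  linear 1F u v = byFirst v ≤ₗ byFirst u
  linear 2F u v = byLastIntervalsFirst v ≤ₗ byLastIntervalsFirst u

  linear-isTotalOrder : ∀ i → IsTotalOrder _≡_ (linear i)
  linear-isTotalOrder 0F = key-isTotalOrder byLast byLast-injective
  linear-isTotalOrder 1F = Flip.isTotalOrder (key-isTotalOrder byFirst byFirst-injective)
  linear-isTotalOrder 2F = Flip.isTotalOrder
    (key-isTotalOrder byLastIntervalsFirst byLastIntervalsFirst-injective)

  _⊑_ : Rel V 0ℓ
  u ⊑ v = ∀ i → linear i u v

  -- Ties at an endpoint of the interval are settled by the second keys: 0 for a point against a
  -- successor in the first order, and `n` against `l < n` in the reversed second one. In the
  -- reversed third order all points come first, because `n + n` exceeds every `last`.
  ∈ᵢ⇒⊑ : ∀ {a I} → _∈ᵢ_ n a I → inj₁ a ⊑ inj₂ I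
  ∈ᵢ⇒⊑ {a} {I} (i≤a , a≤j) 0F with ℕ.m≤n⇒m<n∨m≡n a≤j
  ... | inj₁ a<j = inj₁ a<j
  ... | inj₂ a≡j = inj₂ (a≡j , z≤n)
  ∈ᵢ⇒⊑ {a} {i , l} (i≤a , a≤j) 1F with ℕ.m≤n⇒m<n∨m≡n i≤a
  ... | inj₁ i<a = inj₁ i<a
  ... | inj₂ i≡a = inj₂ (i≡a , ℕ.<⇒≤ (Fin.toℕ<n l))
  ∈ᵢ⇒⊑ {a} {I} _ 2F = inj₁ (ℕ.<-≤-trans (last<2n I) (ℕ.m≤m+n (n + n) (toℕ a)))

  ⊑⇒∈ᵢ : ∀ {a I} → inj₁ a ⊑ inj₂ I → _∈ᵢ_ n a I
  ⊑⇒∈ᵢ a⊑I = ≤ₗ⇒≤ (a⊑I 1F) , ≤ₗ⇒≤ (a⊑I 0F)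

  interval⋢point : ∀ {a I} → ¬ (inj₂ I ⊑ inj₁ a)
  interval⋢point {a} {I} I⊑a =
    ℕ.<⇒≱ (last<2n I) (ℕ.≤-trans (ℕ.m≤m+n (n + n) (toℕ a)) (≤ₗ⇒≤ (I⊑a 2F)))

  -- The first and second orders are opposite on points, just as the first and third are on
  -- intervals.
  points-antichain : ∀ {a b} → inj₁ a ⊑ inj₁ b → a ≡ b
  points-antichain a⊑b = Fin.toℕ-injective (ℕ.≤-antisym (≤ₗ⇒≤ (a⊑b 0F)) (≤ₗ⇒≤ (a⊑b 1F)))

  intervals-antichain : ∀ {I J} → inj₂ I ⊑ inj₂ J → inj₂ I ≡ inj₂ J
  intervals-antichain I⊑J = byLast-injective (≤ₗ-antisym (I⊑J 0F) (I⊑J 2F))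

  intervalGraph-comparability : ComparabilityGraphOfDimensionAtMost G 3
  intervalGraph-comparability = _⊑_ , ⊑-isPartialOrder ,
    (linear , linear-isTotalOrder , λ _ _ → mk⇔ id id) , comparability
    where
    module L i = IsTotalOrder (linear-isTotalOrder i)
    ⊑-isPartialOrder = record
      { isPreorder = record
        { isEquivalence = isEquivalence
        ; reflexive = λ u≡v i → L.reflexive i u≡v
        ; trans = λ u⊑v v⊑w i → L.trans i (u⊑v i) (v⊑w i) }
      ; antisym = λ u⊑v v⊑u → L.antisym 0F (u⊑v 0F) (v⊑u 0F) }
    comparability : IsComparabilityGraphOf G _⊑_
    comparability (inj₁ a) (inj₂ I) = mk⇔ (λ r → (λ ()) , inj₁ (∈ᵢ⇒⊑ r))
      λ { (_ , inj₁ h) → ⊑⇒∈ᵢ h ; (_ , inj₂ h) → contradiction h interval⋢point }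
    comparability (inj₂ I) (inj₁ a) = mk⇔ (λ r → (λ ()) , inj₂ (∈ᵢ⇒⊑ r))
      λ { (_ , inj₂ h) → ⊑⇒∈ᵢ h ; (_ , inj₁ h) → contradiction h interval⋢point }
    comparability (inj₁ a) (inj₁ b) = mk⇔ (λ ())
      λ { (a≢b , inj₁ h) → a≢b (cong inj₁ (points-antichain h))
        ; (a≢b , inj₂ h) → a≢b (cong inj₁ (sym (points-antichain h))) }
    comparability (inj₂ I) (inj₂ J) = mk⇔ (λ ())
      λ { (I≢J , inj₁ h) → I≢J (intervals-antichain h)
        ; (I≢J , inj₂ h) → I≢J (sym (intervals-antichain h)) }

-- Counting in lists

count : ∀ {A : Set} {P : Pred A 0ℓ} → Decidable P → List A → ℕ
count P? xs = length (filter P? xs)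

count-++ : ∀ {A : Set} {P : Pred A 0ℓ} (P? : Decidable P) xs ys →
  count P? (xs ++ ys) ≡ count P? xs + count P? ys
count-++ P? xs ys = trans (cong length (filter-++ P? xs ys)) (length-++ (filter P? xs))

count-map : ∀ {A B : Set} {P : Pred B 0ℓ} (P? : Decidable P) (f : A → B) xs →
  count P? (map f xs) ≡ count (P? ∘ f) xs
count-map P? f [] = refl
count-map P? f (x ∷ xs) with P? (f x)
... | yes _ = cong suc (count-map P? f xs)
... | no _  = count-map P? f xs

count-all : ∀ {A : Set} {P : Pred A 0ℓ} (P? : Decidable P) → (∀ x → P x) → ∀ xs →
  count P? xs ≡ length xs
count-all P? p xs = cong length (filter-all P? (All.universal p xs))

count-none : ∀ {A : Set} {P : Pred A 0ℓ} (P? : Decidable P) → (∀ x → ¬ P x) → ∀ xs →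
  count P? xs ≡ 0
count-none P? ¬p xs = cong length (filter-none P? (All.universal ¬p xs))

count-cong : ∀ {A : Set} {P Q : Pred A 0ℓ} (P? : Decidable P) (Q? : Decidable Q) →
  (∀ {x} → P x → Q x) → (∀ {x} → Q x → P x) → ∀ xs → count P? xs ≡ count Q? xs
count-cong P? Q? p⇒q q⇒p xs = cong length (filter-≐ P? Q? (p⇒q , q⇒p) xs)

Enumeration : Set → Set
Enumeration A = ∃[ xs ] (Unique xs × ∀ (x : A) → x ∈ xs)

enumeration-⊎ : ∀ {A B} → Enumeration A → Enumeration B → Enumeration (A ⊎ B)
enumeration-⊎ (xs , !xs , ∈xs) (ys , !ys , ∈ys) =
  map inj₁ xs ++ map inj₂ ys ,
  Unique.++⁺ (Unique.map⁺ (λ { refl → refl }) !xs) (Unique.map⁺ (λ { refl → refl }) !ys) disjoint ,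
  λ { (inj₁ x) → ∈-++⁺ˡ (∈-map⁺ inj₁ (∈xs x))
    ; (inj₂ y) → ∈-++⁺ʳ (map inj₁ xs) (∈-map⁺ inj₂ (∈ys y)) }
  where
  disjoint : ∀ {z} → ¬ (z ∈ map inj₁ xs × z ∈ map inj₂ ys)
  disjoint (z∈xs , z∈ys) with _ , _ , refl ← ∈-map⁻ inj₁ z∈xs | _ , _ , () ← ∈-map⁻ inj₂ z∈ys

enumeration-× : ∀ {A B} → Enumeration A → Enumeration B → Enumeration (A × B)
enumeration-× (xs , !xs , ∈xs) (ys , !ys , ∈ys) =
  cartesianProduct xs ys , Unique.cartesianProduct⁺ !xs !ys ,
  λ (x , y) → ∈-cartesianProduct⁺ (∈xs x) (∈ys y)

enumeration-Fin : ∀ n → Enumeration (Fin n)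
enumeration-Fin n = allFin n , Unique.allFin⁺ n , ∈-allFin

enumeration-⊤ : Enumeration ⊤
enumeration-⊤ = tt ∷ [] , [] ∷ [] , λ _ → here refl

-- Degrees are computed along lists built by recursion on the tree. Two duplicate-free lists of all
-- vertices are permutations of each other, so counts may be moved between them.
count-vertices : ∀ G ((xs , _) : Enumeration (Graph.V G)) {P : Pred (Graph.V G) 0ℓ}
  (P? : Decidable P) → count P? (Graph.vertices G) ≡ count P? xs
count-vertices G (xs , !xs , ∈xs) P? = ↭-length (filter-↭ P?
  (∼bag⇒↭ (unique∧set⇒bag (vertices-unique G) !xs (mk⇔ (λ _ → ∈xs _) (λ _ → ∈-vertices G _)))))

odd-3* : ∀ {n} → n % 2 ≡ 1 → (3 * n) % 2 ≡ 1
odd-3* {n} odd = trans (%-distribˡ-* 3 n 2) (cong (λ r → (1 * r) % 2) odd)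

count-Fin3× : ∀ {A : Set} {P : Pred (Fin 3 × A) 0ℓ} (P? : Decidable P) xs →
  count P? (cartesianProduct (allFin 3) xs) ≡
    count (P? ∘ (0F ,_)) xs + (count (P? ∘ (1F ,_)) xs + (count (P? ∘ (2F ,_)) xs + 0))
count-Fin3× P? xs =
  trans (count-++ P? (map (0F ,_) xs) _) (cong₂ _+_ (count-map P? _ xs)
  (trans (count-++ P? (map (1F ,_) xs) _) (cong₂ _+_ (count-map P? _ xs)
  (trans (count-++ P? (map (2F ,_) xs) _) (cong (_+ 0) (count-map P? _ xs))))))

count-branch : ∀ {A : Set} {P : Pred (Fin 3 × A) 0ℓ} (P? : Decidable P) i →
  (∀ {j} → j ≢ i → ∀ x → ¬ P (j , x)) → ∀ xs →
  count P? (cartesianProduct (allFin 3) xs) ≡ count (P? ∘ (i ,_)) xs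
count-branch P? 0F other xs = trans (count-Fin3× P? xs)
  (trans (cong₂ (λ m n → count (P? ∘ (0F ,_)) xs + (m + (n + 0)))
    (count-none (P? ∘ (1F ,_)) (other λ ()) xs) (count-none (P? ∘ (2F ,_)) (other λ ()) xs))
    (ℕ.+-identityʳ _))
count-branch P? 1F other xs = trans (count-Fin3× P? xs)
  (trans (cong₂ (λ m n → m + (count (P? ∘ (1F ,_)) xs + (n + 0)))
    (count-none (P? ∘ (0F ,_)) (other λ ()) xs) (count-none (P? ∘ (2F ,_)) (other λ ()) xs))
    (ℕ.+-identityʳ _))
count-branch P? 2F other xs = trans (count-Fin3× P? xs)
  (trans (cong₂ (λ m n → m + (n + (count (P? ∘ (2F ,_)) xs + 0)))
    (count-none (P? ∘ (0F ,_)) (other λ ()) xs) (count-none (P? ∘ (1F ,_)) (other λ ()) xs))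
    (ℕ.+-identityʳ _))

-- The tree graph

-- The complete ternary tree of height h; its leaves also count as nodes.
Leaf Node : ℕ → Set
Leaf zero    = ⊤
Leaf (suc h) = Fin 3 × Leaf h
Node zero    = ⊤
Node (suc h) = ⊤ ⊎ (Fin 3 × Node h)

Below : ∀ h → Leaf h → Node h → Set
Below zero    _       _              = ⊤
Below (suc h) _       (inj₁ _)       = ⊤
Below (suc h) (i , l) (inj₂ (j , b)) = i ≡ j × Below h l b

below? : ∀ h l b → Dec (Below h l b)
below? zero    _       _              = yes tt
below? (suc h) _       (inj₁ _)       = yes tt
below? (suc h) (i , l) (inj₂ (j , b)) = i Fin.≟ j ×-dec below? h l b

finite-⊤ : Finite ⊤
finite-⊤ = 1 , ↔-sym Fin.1↔⊤

finite-Leaf : ∀ h → Finite (Leaf h)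
finite-Leaf zero    = finite-⊤
finite-Leaf (suc h) = finite-× (finite-Fin 3) (finite-Leaf h)

finite-Node : ∀ h → Finite (Node h)
finite-Node zero    = finite-⊤
finite-Node (suc h) = finite-⊎ finite-⊤ (finite-× (finite-Fin 3) (finite-Node h))

treeGraph : ℕ → Graph
treeGraph h = incidenceGraph (Below h) (finite-Leaf h) (finite-Node h) (below? h)

leaves : ∀ h → Enumeration (Leaf h)
leaves zero    = enumeration-⊤
leaves (suc h) = enumeration-× (enumeration-Fin 3) (leaves h)

nodes : ∀ h → Enumeration (Node h)
nodes zero    = enumeration-⊤
nodes (suc h) = enumeration-⊎ enumeration-⊤ (enumeration-× (enumeration-Fin 3) (nodes h))

leafList : ∀ h → List (Leaf h)
leafList h = proj₁ (leaves h)

nodeList : ∀ h → List (Node h)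
nodeList h = proj₁ (nodes h)

-- The nodes counted form the path from the root to the leaf, one per level with both ends included.
nodesAbove : ∀ h l → count (below? h l) (nodeList h) ≡ suc h
nodesAbove zero    l       = refl
nodesAbove (suc h) (i , l) = cong suc (begin
  count (below? (suc h) (i , l)) (map inj₂ (cartesianProduct (allFin 3) (nodeList h)))
    ≡⟨ count-map (below? (suc h) (i , l)) inj₂ (cartesianProduct (allFin 3) (nodeList h)) ⟩
  count (below? (suc h) (i , l) ∘ inj₂) (cartesianProduct (allFin 3) (nodeList h))
    ≡⟨ count-branch (below? (suc h) (i , l) ∘ inj₂) i (λ j≢i _ (i≡j , _) → j≢i (sym i≡j)) (nodeList h) ⟩
  count (below? (suc h) (i , l) ∘ inj₂ ∘ (i ,_)) (nodeList h)
    ≡⟨ count-cong _ (below? h l) proj₂ (refl ,_) (nodeList h) ⟩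
  count (below? h l) (nodeList h)
    ≡⟨ nodesAbove h l ⟩
  suc h ∎)
  where open ≡-Reasoning

-- The length is a power of three. It is read as a count of the trivial predicate so that
-- `count-Fin3×` supplies the factor three.
leafList-odd : ∀ h → length (leafList h) % 2 ≡ 1
leafList-odd zero    = refl
leafList-odd (suc h) = trans (cong (_% 2) (trans
  (sym (count-all {P = λ _ → ⊤} (λ _ → yes tt) _ (leafList (suc h))))
  (trans (count-Fin3× {P = λ _ → ⊤} (λ _ → yes tt) (leafList h))
    (cong (3 *_) (count-all {P = λ _ → ⊤} (λ _ → yes tt) _ (leafList h))))))
  (odd-3* {length (leafList h)} (leafList-odd h))

leavesBelow-odd : ∀ h b → count (λ l → below? h l b) (leafList h) % 2 ≡ 1
leavesBelow-odd zero    b              = refl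
leavesBelow-odd (suc h) (inj₁ b)       = trans
  (cong (_% 2) (count-all (λ l → below? (suc h) l (inj₁ b)) _ (leafList (suc h))))
  (leafList-odd (suc h))
leavesBelow-odd (suc h) (inj₂ (j , b)) = trans
  (cong (_% 2) (trans
    (count-branch (λ l → below? (suc h) l (inj₂ (j , b))) j (λ i≢j _ (i≡j , _) → i≢j i≡j) (leafList h))
    (count-cong _ (λ l → below? h l b) proj₂ (refl ,_) (leafList h))))
  (leavesBelow-odd h b)

-- Degrees and colourings of the tree graph

module _ (h : ℕ) where
  private
    G = treeGraph h
  open Graph G

  degree-leaf : ∀ l → length (neighbours (inj₁ l)) ≡ suc h
  degree-leaf l = begin
    count (adj? (inj₁ l)) vertices
      ≡⟨ count-vertices G (enumeration-⊎ (leaves h) (nodes h)) (adj? (inj₁ l)) ⟩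
    count (adj? (inj₁ l)) (map inj₁ (leafList h) ++ map inj₂ (nodeList h))
      ≡⟨ count-++ (adj? (inj₁ l)) (map inj₁ (leafList h)) _ ⟩
    count (adj? (inj₁ l)) (map inj₁ (leafList h)) + count (adj? (inj₁ l)) (map inj₂ (nodeList h))
      ≡⟨ cong₂ _+_ (trans (count-map (adj? (inj₁ l)) inj₁ (leafList h))
                          (count-none (adj? (inj₁ l) ∘ inj₁) (λ _ ()) (leafList h)))
                   (count-map (adj? (inj₁ l)) inj₂ (nodeList h)) ⟩
    count (below? h l) (nodeList h)
      ≡⟨ nodesAbove h l ⟩
    suc h ∎
    where open ≡-Reasoning

  degree-node : ∀ b → length (neighbours (inj₂ b)) % 2 ≡ 1
  degree-node b = trans (cong (_% 2) (begin
    count (adj? (inj₂ b)) vertices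
      ≡⟨ count-vertices G (enumeration-⊎ (leaves h) (nodes h)) (adj? (inj₂ b)) ⟩
    count (adj? (inj₂ b)) (map inj₁ (leafList h) ++ map inj₂ (nodeList h))
      ≡⟨ count-++ (adj? (inj₂ b)) (map inj₁ (leafList h)) _ ⟩
    count (adj? (inj₂ b)) (map inj₁ (leafList h)) + count (adj? (inj₂ b)) (map inj₂ (nodeList h))
      ≡⟨ cong₂ _+_ (count-map (adj? (inj₂ b)) inj₁ (leafList h))
                   (trans (count-map (adj? (inj₂ b)) inj₂ (nodeList h))
                          (count-none (adj? (inj₂ b) ∘ inj₂) (λ _ ()) (nodeList h))) ⟩
    count (λ l → below? h l b) (leafList h) + 0
      ≡⟨ ℕ.+-identityʳ _ ⟩
    count (λ l → below? h l b) (leafList h) ∎)) (leavesBelow-odd h b)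
    where open ≡-Reasoning

  bipartition : Colouring G 2
  bipartition (inj₁ _) = 0F
  bipartition (inj₂ _) = 1F

  -- Every vertex sees a single colour, as often as its degree. The hypothesis is the parity of the
  -- degree of a leaf.
  bipartition-properOdd : suc h % 2 ≡ 1 → ProperOdd G bipartition
  bipartition-properOdd odd =
    (λ { (inj₁ _) (inj₂ _) _ () ; (inj₂ _) (inj₁ _) _ () }) ,
    λ { (inj₁ l) _ → 1F , trans (cong (_% 2)
          (trans (all-neighbours (inj₁ l) 1F λ { (inj₂ _) _ → refl }) (degree-leaf l))) odd
      ; (inj₂ b) _ → 0F , trans (cong (_% 2)
          (all-neighbours (inj₂ b) 0F λ { (inj₁ _) _ → refl })) (degree-node b) }
    where
    all-neighbours : ∀ v a → (∀ u → Adj v u → bipartition u ≡ a) →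
      occurrences G bipartition v a ≡ length (neighbours v)
    all-neighbours v a eq = cong length
      (filter-all (λ u → bipartition u Fin.≟ a)
        (All.tabulate λ {u} u∈ → eq u (∈-neighbours⁻ G {u} {v} u∈)))

-- Only the leaf colours are retained, which lets the hypothesis pass to the subtree at a child;
-- each step of the induction gives up one level and one colour.
uniqueBelow⇒h<k : ∀ h {k} (c : Leaf h → Fin k) →
  (∀ b → ∃[ l ] (Below h l b × ∀ l′ → Below h l′ b → c l′ ≡ c l → l′ ≡ l)) → h < k
uniqueBelow⇒h<k zero {suc k} c _ = s≤s z≤n
uniqueBelow⇒h<k zero {zero} c _ with () ← c tt
uniqueBelow⇒h<k (suc h) {zero} c uniq with () ← c (proj₁ (uniq (inj₁ tt)))
uniqueBelow⇒h<k (suc h) {suc k} c uniq with uniq (inj₁ tt)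
... | (i , l) , _ , only = s≤s (uniqueBelow⇒h<k h c′ uniq′)
  where
  -- A child different from `i`, in whose subtree the colour of the leaf `(i , l)` cannot occur
  -- again.
  j = punchIn i 0F

  avoids : ∀ m → c (i , l) ≢ c (j , m)
  avoids m eq = Fin.punchInᵢ≢i i 0F (cong proj₁ (only (j , m) tt (sym eq)))

  c′ : Leaf h → Fin k
  -- Removes the avoided colour from the palette, leaving `k` of the `suc k` colours.
  c′ m = punchOut (avoids m)

  uniq′ : ∀ b → ∃[ m ] (Below h m b × ∀ m′ → Below h m′ b → c′ m′ ≡ c′ m → m′ ≡ m)
  uniq′ b with uniq (inj₂ (j , b))
  ... | (_ , m) , (refl , m<b) , only′ = m , m<b , λ m′ m′<b eq →
    cong proj₂ (only′ (j , m′) (refl , m′<b)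
      (Fin.punchOut-injective (avoids m′) (avoids m) eq))

aLeaf : ∀ h → Leaf h
aLeaf zero    = tt
aLeaf (suc h) = 0F , aLeaf h

aLeafBelow : ∀ h b → ∃[ l ] Below h l b
aLeafBelow zero    b              = tt , tt
aLeafBelow (suc h) (inj₁ b)       = aLeaf (suc h) , tt
aLeafBelow (suc h) (inj₂ (j , b)) = let l , l<b = aLeafBelow h b in (j , l) , refl , l<b

properConflictFree⇒h<k : ∀ h {k} (c : Colouring (treeGraph h) k) →
  ProperConflictFree (treeGraph h) c → h < k
properConflictFree⇒h<k h c (_ , pcf) = uniqueBelow⇒h<k h (c ∘ inj₁) uniq
  where
  uniq : ∀ b → ∃[ l ] (Below h l b × ∀ l′ → Below h l′ b → c (inj₁ l′) ≡ c (inj₁ l) → l′ ≡ l)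
  uniq b with pcf (inj₂ b) (let l , l<b = aLeafBelow h b in inj₁ l , l<b)
  ... | a , occ with occurrences≡1⁻ (treeGraph h) c {inj₂ b} occ
  ... | inj₁ l , l<b , refl , only = l , l<b , λ l′ l′<b eq → inj₁-injective (only (inj₁ l′) l′<b eq)
    where
    inj₁-injective : ∀ {x y : Leaf h} → inj₁ {B = Node h} x ≡ inj₁ y → x ≡ y
    inj₁-injective refl = refl

-- Depth-first layout and chords for the tree graph

width : ℕ → ℕ
width zero    = 3
width (suc h) = suc (suc (3 * width h))

-- The children's traversals occupy consecutive blocks of `w` positions. The shift by one makes room
-- for entering the root; the second extra position in `width` is for leaving it.
offset : ℕ → Fin 3 → ℕ → ℕ
offset w i x = suc (toℕ i * w + x)

offset-mono : ∀ w i {x y} → x < y → offset w i x < offset w i y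
offset-mono w i x<y = s≤s (ℕ.+-monoʳ-< (toℕ i * w) x<y)

offset-block : ∀ w {i j x y} → toℕ i < toℕ j → x < w → offset w i x < offset w j y
offset-block w {i} {j} {x} {y} i<j x<w = s≤s (begin-strict
  toℕ i * w + x   <⟨ ℕ.+-monoʳ-< (toℕ i * w) x<w ⟩
  toℕ i * w + w   ≡⟨ ℕ.+-comm (toℕ i * w) w ⟩
  suc (toℕ i) * w ≤⟨ ℕ.*-monoˡ-≤ w i<j ⟩
  toℕ j * w       ≤⟨ ℕ.m≤m+n _ y ⟩
  toℕ j * w + y   ∎)
  where open ℕ.≤-Reasoning

offset-bound : ∀ w i {x} → x < w → offset w i x < suc (3 * w)
offset-bound w i {x} x<w = s≤s (begin-strict
  toℕ i * w + x   <⟨ ℕ.+-monoʳ-< (toℕ i * w) x<w ⟩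
  toℕ i * w + w   ≡⟨ ℕ.+-comm (toℕ i * w) w ⟩
  suc (toℕ i) * w ≤⟨ ℕ.*-monoˡ-≤ w (Fin.toℕ<n i) ⟩
  3 * w           ∎)
  where open ℕ.≤-Reasoning

-- Positions of a depth-first traversal: a leaf is visited once, a node is
-- entered at lo and left at hi.
pos : ∀ h → Leaf h → ℕ
pos zero    _       = 1
pos (suc h) (i , l) = offset (width h) i (pos h l)

lo hi : ∀ h → Node h → ℕ
lo zero    _              = 0
lo (suc h) (inj₁ _)       = 0
lo (suc h) (inj₂ (j , b)) = offset (width h) j (lo h b)
hi zero    _              = 2
hi (suc h) (inj₁ _)       = suc (3 * width h)
hi (suc h) (inj₂ (j , b)) = offset (width h) j (hi h b)

pos<width : ∀ h l → pos h l < width h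
pos<width zero    _       = s≤s (s≤s z≤n)
pos<width (suc h) (i , l) = ℕ.m<n⇒m<1+n (offset-bound (width h) i (pos<width h l))

hi<width : ∀ h b → hi h b < width h
hi<width zero    _              = ℕ.≤-refl
hi<width (suc h) (inj₁ _)       = ℕ.≤-refl
hi<width (suc h) (inj₂ (j , b)) = ℕ.m<n⇒m<1+n (offset-bound (width h) j (hi<width h b))

lo<hi : ∀ h b → lo h b < hi h b
lo<hi zero    _              = s≤s z≤n
lo<hi (suc h) (inj₁ _)       = s≤s z≤n
lo<hi (suc h) (inj₂ (j , b)) = offset-mono (width h) j (lo<hi h b)

below⇒between : ∀ h l b → Below h l b → lo h b < pos h l × pos h l < hi h b
below⇒between zero    _       _              _           = s≤s z≤n , s≤s (s≤s z≤n)
below⇒between (suc h) (i , l) (inj₁ _)       _           =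
  s≤s z≤n , offset-bound (width h) i (pos<width h l)
below⇒between (suc h) (i , l) (inj₂ (_ , b)) (refl , l<b) =
  let p , q = below⇒between h l b l<b in offset-mono (width h) i p , offset-mono (width h) i q

¬below⇒outside : ∀ h l b → ¬ Below h l b → pos h l < lo h b ⊎ hi h b < pos h l
¬below⇒outside zero    _       _              ¬l<b = contradiction tt ¬l<b
¬below⇒outside (suc h) _       (inj₁ _)       ¬l<b = contradiction tt ¬l<b
¬below⇒outside (suc h) (i , l) (inj₂ (j , b)) ¬l<b with Fin.<-cmp i j
... | tri< i<j _ _  = inj₁ (offset-block (width h) {i} {j} i<j (pos<width h l))
... | tri> _ _ j<i  = inj₂ (offset-block (width h) {j} {i} j<i (hi<width h b))
... | tri≈ _ refl _ = Sum.map (offset-mono (width h) i) (offset-mono (width h) i)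
  (¬below⇒outside h l b λ l<b → ¬l<b (refl , l<b))

pos-distinct : ∀ h l m → l ≢ m → pos h l < pos h m ⊎ pos h m < pos h l
pos-distinct zero    _       _       l≢m = contradiction refl l≢m
pos-distinct (suc h) (i , l) (j , m) l≢m with Fin.<-cmp i j
... | tri< i<j _ _  = inj₁ (offset-block (width h) {i} {j} i<j (pos<width h l))
... | tri> _ _ j<i  = inj₂ (offset-block (width h) {j} {i} j<i (pos<width h m))
... | tri≈ _ refl _ = Sum.map (offset-mono (width h) i) (offset-mono (width h) i)
  (pos-distinct h l m (l≢m ∘ cong (i ,_)))

Precedes Inside : ∀ h → Node h → Node h → Set
Precedes h b c = hi h b < lo h c
Inside   h b c = lo h c < lo h b × hi h b < hi h c

-- Different children have disjoint blocks and the root encloses all of them. The strict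
-- inequalities exclude common endpoints, as the chord lemmas require.
laminar : ∀ h b c → b ≢ c → (Precedes h b c ⊎ Precedes h c b) ⊎ (Inside h b c ⊎ Inside h c b)
laminar zero    _        _        b≢c = contradiction refl b≢c
laminar (suc h) (inj₁ _) (inj₁ _) b≢c = contradiction refl b≢c
laminar (suc h) (inj₁ _) (inj₂ (j , c)) _ =
  inj₂ (inj₂ (s≤s z≤n , offset-bound (width h) j (hi<width h c)))
laminar (suc h) (inj₂ (i , b)) (inj₁ _) _ =
  inj₂ (inj₁ (s≤s z≤n , offset-bound (width h) i (hi<width h b)))
laminar (suc h) (inj₂ (i , b)) (inj₂ (j , c)) b≢c with Fin.<-cmp i j
... | tri< i<j _ _  = inj₁ (inj₁ (offset-block (width h) {i} {j} i<j (hi<width h b)))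
... | tri> _ _ j<i  = inj₁ (inj₂ (offset-block (width h) {j} {i} j<i (hi<width h c)))
... | tri≈ _ refl _ = Sum.map (Sum.map mono mono) (Sum.map mono₂ mono₂)
  (laminar h b c (b≢c ∘ cong (inj₂ ∘ (i ,_))))
  where
  mono : ∀ {x y} → x < y → offset (width h) i x < offset (width h) i y
  mono = offset-mono (width h) i
  mono₂ : ∀ {x y u v} → x < y × u < v →
    offset (width h) i x < offset (width h) i y × offset (width h) i u < offset (width h) i v
  mono₂ (p , q) = mono p , mono q

module _ (h : ℕ) where
  private
    G = treeGraph h
  open Graph G

  neg<pos : ∀ m n → fromℤ -[1+ m ] ℚ.< fromℤ (+ n)
  neg<pos m n = fromℤ-mono-< -<+

  neg<neg : ∀ {m n} → m < n → fromℤ -[1+ n ] ℚ.< fromℤ -[1+ m ]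
  neg<neg m<n = fromℤ-mono-< (-<- m<n)

  lo<hiℚ : ∀ b → fromℕ (lo h b) ℚ.< fromℕ (hi h b)
  lo<hiℚ b = fromℕ-mono-< (lo<hi h b)

  -- The leaf at position `p` gets the chord from parameter `-(p + 1)` to `p`, so the leaf chords
  -- are nested in one another. Node chords have nonnegative parameters, so the negative end never
  -- falls inside their range, and a crossing is decided by whether `p` lies between `lo` and `hi`.
  treeChord : V → Segment
  treeChord (inj₁ l) = chord (neg<pos (pos h l) (pos h l))
  treeChord (inj₂ b) = chord (lo<hiℚ b)

  leaf-node⁺ : ∀ l b → Below h l b → Intersect (treeChord (inj₁ l)) (treeChord (inj₂ b))
  leaf-node⁺ l b l<b = let lo<pos , pos<hi = below⇒between h l b l<b in
    interleaved⇒intersect (neg<pos (pos h l) (pos h l)) (lo<hiℚ b)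
      (neg<pos (pos h l) (lo h b)) (fromℕ-mono-< lo<pos) (fromℕ-mono-< pos<hi)

  leaf-node⁻ : ∀ l b → ¬ Below h l b → ¬ Intersect (treeChord (inj₁ l)) (treeChord (inj₂ b))
  leaf-node⁻ l b ¬l<b = [ left , right ]′ (¬below⇒outside h l b ¬l<b)
    where
    left : pos h l < lo h b → ¬ Intersect (treeChord (inj₁ l)) (treeChord (inj₂ b))
    left pos<lo = disjoint⇒¬intersect
      {s<t = neg<pos (pos h l) (pos h l)} {lo<hiℚ b} (fromℕ-mono-< pos<lo)
    right : hi h b < pos h l → ¬ Intersect (treeChord (inj₁ l)) (treeChord (inj₂ b))
    right hi<pos ∩ = nested⇒¬intersect
      {s<t = lo<hiℚ b} {neg<pos (pos h l) (pos h l)}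
      (neg<pos (pos h l) (lo h b)) (fromℕ-mono-< hi<pos)
      (intersect-sym {treeChord (inj₁ l)} {treeChord (inj₂ b)} ∩)

  leaf-leaf : ∀ l m → l ≢ m → ¬ Intersect (treeChord (inj₁ l)) (treeChord (inj₁ m))
  leaf-leaf l m l≢m ∩ =
    [ (λ l<m → inside l m l<m ∩)
    , (λ m<l → inside m l m<l (intersect-sym {treeChord (inj₁ l)} {treeChord (inj₁ m)} ∩))
    ]′ (pos-distinct h l m l≢m)
    where
    inside : ∀ l m → pos h l < pos h m → ¬ Intersect (treeChord (inj₁ l)) (treeChord (inj₁ m))
    inside l m l<m = nested⇒¬intersect
      {s<t = neg<pos (pos h l) (pos h l)} {neg<pos (pos h m) (pos h m)}
      (neg<neg l<m) (fromℕ-mono-< l<m)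

  node-node : ∀ b c → b ≢ c → ¬ Intersect (treeChord (inj₂ b)) (treeChord (inj₂ c))
  node-node b c b≢c ∩ =
    [ [ (λ b<c → precedes b c b<c ∩) , (λ c<b → precedes c b c<b ∩ᵒ) ]′
    , [ (λ b⊂c → inside b c b⊂c ∩) , (λ c⊂b → inside c b c⊂b ∩ᵒ) ]′
    ]′ (laminar h b c b≢c)
    where
    ∩ᵒ = intersect-sym {treeChord (inj₂ b)} {treeChord (inj₂ c)} ∩
    precedes : ∀ b c → Precedes h b c → ¬ Intersect (treeChord (inj₂ b)) (treeChord (inj₂ c))
    precedes b c b<c = disjoint⇒¬intersect {s<t = lo<hiℚ b} {lo<hiℚ c} (fromℕ-mono-< b<c)
    inside : ∀ b c → Inside h b c → ¬ Intersect (treeChord (inj₂ b)) (treeChord (inj₂ c))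
    inside b c (p , q) = nested⇒¬intersect {s<t = lo<hiℚ b} {lo<hiℚ c}
      (fromℕ-mono-< p) (fromℕ-mono-< q)

  treeGraph-circleGraph : CircleGraph G
  treeGraph-circleGraph = unitCircle , treeChord ,
    (λ { (inj₁ l) → chord-isChord (neg<pos (pos h l) (pos h l))
       ; (inj₂ b) → chord-isChord (lo<hiℚ b) }) ,
    intersection
    where
    intersect⇒below : ∀ l b → Intersect (treeChord (inj₁ l)) (treeChord (inj₂ b)) → Below h l b
    intersect⇒below l b ∩ = decidable-stable (below? h l b) λ ¬l<b → leaf-node⁻ l b ¬l<b ∩
    intersection : IsIntersectionGraphOf G treeChord
    intersection (inj₁ l) (inj₂ b) _ = mk⇔ (leaf-node⁺ l b) (intersect⇒below l b)
    intersection (inj₂ b) (inj₁ l) _ = mk⇔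
      (λ l<b → intersect-sym {treeChord (inj₁ l)} {treeChord (inj₂ b)} (leaf-node⁺ l b l<b))
      (λ ∩ → intersect⇒below l b (intersect-sym {treeChord (inj₂ b)} {treeChord (inj₁ l)} ∩))
    intersection (inj₁ l) (inj₁ m) l≢m = mk⇔ (λ ()) (leaf-leaf l m (l≢m ∘ cong inj₁))
    intersection (inj₂ b) (inj₂ c) b≢c = mk⇔ (λ ()) (node-node b c (b≢c ∘ cong inj₂))

  treeGraph-bipartite : Bipartite G
  treeGraph-bipartite = isPoint (Below h) , incident⇒sides≢ (Below h)

-- The two graph classes

theorem1p7 : (Σ GraphClass λ 𝒢 →
    (∀ G → 𝒢 G →
    ConvexBipartite G × GridIntersection G × ComparabilityGraphOfDimensionAtMost G 3)
    × Unbounded χₒ 𝒢)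
    × (Σ GraphClass λ ℋ →
    (∀ H → ℋ H → Bipartite H × CircleGraph H)
    × Bounded χₒ ℋ
    × Unbounded χpcf ℋ)
theorem1p7 =
  ((λ G → ∃[ n ] G ≡ intervalGraph n) ,
   (λ { _ (n , refl) → intervalGraph-convexBipartite n , intervalGraph-gridIntersection n ,
                       intervalGraph-comparability n }) ,
   -- On `2 ^ b` points a proper odd colouring with `n` colours forces `2 ^ b < 2 ^ n`, hence
   -- `b < n`.
   λ b → let n , isχ@((c , odd) , _) = χₒ-exists (intervalGraph (2 ^ b))
         in intervalGraph (2 ^ b) , (2 ^ b , refl) , n , isχ ,
            ℕ.≰⇒> λ n≤b → ℕ.<⇒≱ (properOdd⇒n<2^k (2 ^ b) c odd) (ℕ.^-monoʳ-≤ 2 n≤b)) ,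
  -- Heights of the form `m * 2` make the leaf degree `1 + m * 2` odd; height `b * 2` is at least
  -- `b`, which is enough for the lower bound.
  ((λ H → ∃[ m ] H ≡ treeGraph (m * 2)) ,
   (λ { _ (m , refl) → treeGraph-bipartite (m * 2) , treeGraph-circleGraph (m * 2) }) ,
   (2 , λ { _ (m , refl) → let n , isχ@(_ , minimal) = χₒ-exists (treeGraph (m * 2))
            in n , isχ , minimal 2 (bipartition (m * 2) ,
                 bipartition-properOdd (m * 2) ([m+kn]%n≡m%n 1 m 2)) }) ,
   λ b → let n , isχ@((c , pcf) , _) = chromaticNumber (treeGraph (b * 2)) (ℕ._≟ 1) refl
         in treeGraph (b * 2) , (b , refl) , n , isχ ,
            ℕ.≤-<-trans (ℕ.m≤m*n b 2) (properConflictFree⇒h<k (b * 2) c pcf))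
  where
  χₒ-exists : ∀ G → ∃ (χₒ G)
  χₒ-exists G = chromaticNumber G (λ n → n % 2 ℕ.≟ 1) refl
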